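{- Let $\mathcal{F}$ be a periodic infinite frieze of positive integers with growth coefficients $(s_k)_{k\ge0}$. The following are equivalent: (a) There exists $k>0$ such that $s_k>2$. (b) $s_k>2$ for all $k>0$. (c) $\mathcal{F}$ does not arise from a triangulation of a punctured disc.
   Context: An infinite frieze of positive integers is an array $(m_{i,j})$, indexed by $i\in\mathbb{Z}$ and $j\ge i-2$, with $m_{i,i-2}=0$, $m_{i,i-1}=1$, with $m_{i,j}$ a positive integer for $j\ge i-1$, and with $m_{i,j}m_{i+1,j+1}-m_{i,j+1}m_{i+1,j}=1$ for all $i$ and all $j\ge i-1$. It is periodic if for some $n\ge1$ one has $m_{i+n,j+n}=m_{i,j}$ for all entries. With $n$ the minimal such period, the growth coefficients are $s_0:=2$ and $s_k:=m_{1,kn}-m_{2,kn-1}$ for $k\ge1$. The quiddity row is $a_i=m_{i,i}$; a finite block of consecutive entries whose periodic repetition is the quiddity row is called a quiddity sequence of the frieze (its length is a period, not necessarily minimal). A triangulation of a punctured disc is a maximal collection of pairwise non-crossing (non-self-crossing) arcs, up to isotopy, in the once-punctured disc with $N\ge1$ marked points on its boundary, with endpoints in the set consisting of the marked points and the puncture, none of which is contractible or isotopic to a boundary segment (loops based at boundary marked points around the puncture are allowed). It gives the sequence $(a_1,\dots,a_N)$, where $a_i$ is the number of regions incident with the boundary marked point $i$, counted in a small neighbourhood of it (i.e. one plus the number of ends of arcs at $i$), marked points being taken in cyclic order. A periodic infinite frieze of positive integers arises from a triangulation of a punctured disc if it has a quiddity sequence obtained in this way. It is known (Baur–Parsons–Tschabold)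 that every such triangulation yields a periodic infinite frieze of positive integers, that triangulations of annuli do so likewise (for each boundary component), and that every periodic infinite frieze of positive integers arises from a triangulation of a punctured disc or of an annulus. -}

module Defs where

open import Data.Nat.Base as ℕ using (ℕ; zero; suc; NonZero)
open import Data.Nat.DivMod using (_mod_)
open import Data.Integer.Base using (ℤ; +_; 0ℤ; 1ℤ; _+_; _-_; _*_; _≤_; _<_)
open import Data.Fin.Base using (Fin; toℕ)
open import Data.Fin.Properties using (_≟_)
open import Data.List.Base using (List; []; _∷_; length; filter; concatMap)
open import Data.List.Membership.Propositional using (_∈_)
open import Data.List.Relation.Unary.Unique.Propositional using (Unique)
open import Data.Product.Base using (Σ-syntax; ∃-syntax; _×_)
open import Data.Sum.Base using (_⊎_)
open import Data.Empty using (⊥)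
open import Relation.Binary.PropositionalEquality.Core using (_≡_)
open import Relation.Nullary.Negation.Core using (¬_)

-- The entries m i j of the array are those with j ≥ i - 2.  The function m is
-- total for convenience: its values at j < i - 2 are unconstrained, and nothing
-- below refers to them.
record InfiniteFrieze : Set where
  field
    m        : ℤ → ℤ → ℤ
    zeros    : ∀ i → m i (i - + 2) ≡ 0ℤ
    ones     : ∀ i → m i (i - 1ℤ) ≡ 1ℤ
    positive : ∀ i j → i - 1ℤ ≤ j → 0ℤ < m i j
    diamond  : ∀ i j → i - 1ℤ ≤ j →
               m i j * m (i + 1ℤ) (j + 1ℤ) - m i (j + 1ℤ) * m (i + 1ℤ) j ≡ 1ℤ

module _ (F : InfiniteFrieze) where
  open InfiniteFrieze F

  quiddity : ℤ → ℤ
  quiddity i = m i i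

  IsPeriod : ℕ → Set
  IsPeriod n = 1 ℕ.≤ n × (∀ i j → i - + 2 ≤ j → m (i + + n) (j + + n) ≡ m i j)

  -- F is periodic exactly when it has a minimal period.
  IsMinimalPeriod : ℕ → Set
  IsMinimalPeriod n = IsPeriod n × (∀ n′ → IsPeriod n′ → n ℕ.≤ n′)

  -- growth n k is the growth coefficient s_k when n is the minimal period of F.
  growth : ℕ → ℕ → ℤ
  growth n zero    = + 2
  growth n (suc k) = m (+ 1) (+ (suc k ℕ.* n)) - m (+ 2) (+ (suc k ℕ.* n) - 1ℤ)

  IsQuidditySequence : (N : ℕ) → (Fin N → ℕ) → Set
  IsQuidditySequence N a =
    ∃[ r ] (∀ (k : ℤ) (x : Fin N) → quiddity (r + + toℕ x + k * + N) ≡ + a x)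

-- Isotopy classes of arcs in the once-punctured disc with N marked points on
-- its boundary, labelled by Fin N in cyclic order.
--
-- The universal cover of the disc minus the puncture is a half-plane whose
-- boundary line carries the lifts x + kN (k ∈ ℤ) of each marked point x, the
-- puncture being at infinity.
--   * peripheral x ℓ joins two marked points: it runs from x around the
--     boundary in the cyclic direction, along ℓ boundary segments, with the
--     puncture on the other side.  Its lifts join x + kN to x + ℓ + kN.
--     An arc with ℓ = 0 is contractible, with ℓ = 1 isotopic to a boundary
--     segment, and with ℓ > N crosses itself; with ℓ = N it is the loop at x
--     around the puncture.  For distinct marked points x, y, the two arcs
--     between them on either side of the puncture are listed as one starting
--     from x and one starting from y.
--   * central x joins x to the puncture; its lifts are vertical rays.
-- A non-self-crossing loop based at the puncture is contractible.
data Arc (N : ℕ) : Set where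
  peripheral : (x : Fin N) (ℓ : ℕ) → 2 ℕ.≤ ℓ → ℓ ℕ.≤ N → Arc N
  central    : (x : Fin N) → Arc N

Interlaced : (p q r s : ℤ) → Set
Interlaced p q r s = (p < r × r < q × q < s) ⊎ (r < p × p < s × s < q)

StrictlyBetween : (p q r : ℤ) → Set
StrictlyBetween p q r = p < r × r < q

-- Two isotopy classes cross (have no disjoint representatives, apart from
-- endpoints) when a lift of one crosses some lift of the other; up to deck
-- transformations the first lift can be fixed.
Cross : ∀ {N} → Arc N → Arc N → Set
Cross {N} (peripheral x ℓ _ _) (peripheral y ℓ′ _ _) =
  ∃[ k ] Interlaced (+ toℕ x) (+ toℕ x + + ℓ)
                    (+ toℕ y + k * + N) (+ toℕ y + + ℓ′ + k * + N)
Cross {N} (peripheral x ℓ _ _) (central y) =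
  ∃[ k ] StrictlyBetween (+ toℕ x) (+ toℕ x + + ℓ) (+ toℕ y + k * + N)
Cross {N} (central x) (peripheral y ℓ _ _) =
  ∃[ k ] StrictlyBetween (+ toℕ y) (+ toℕ y + + ℓ) (+ toℕ x + k * + N)
Cross (central _) (central _) = ⊥

record Triangulation (N : ℕ) : Set where
  field
    arcs        : List (Arc N)
    distinct    : Unique arcs
    noncrossing : ∀ {α β} → α ∈ arcs → β ∈ arcs → ¬ Cross α β
    maximal     : ∀ α → (∀ {β} → β ∈ arcs → ¬ Cross α β) → α ∈ arcs

module _ {N : ℕ} .{{_ : NonZero N}} where

  boundaryEnds : Arc N → List (Fin N)
  boundaryEnds (peripheral x ℓ _ _) = x ∷ ((toℕ x ℕ.+ ℓ) mod N) ∷ []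
  boundaryEnds (central x)          = x ∷ []

  -- The number of regions at x, counted in a small neighbourhood of x: the
  -- ends of arcs at x cut a half-disc around x into one more piece than there
  -- are ends (a loop at x has two ends there).
  regionsAt : Triangulation N → Fin N → ℕ
  regionsAt T x =
    suc (length (filter (x ≟_) (concatMap boundaryEnds (Triangulation.arcs T))))

ArisesFromPuncturedDisc : InfiniteFrieze → Set
ArisesFromPuncturedDisc F =
  ∃[ N ] Σ[ nz ∈ NonZero N ] Σ[ T ∈ Triangulation N ]
    IsQuidditySequence F N (regionsAt {{nz}} T)

{-# OPTIONS --safe #-}
-- Let v i ∈ ℤ² (i ∈ ℤ) solve v (i-1) + v (i+1) = a i · v i, where a is the quiddity row and v 0, v 1
-- is the standard basis.  Then m (i+1) (j-1) = det (v i) (v j) =: D i j, so Ptolemy's relation holds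
-- for D, and s k is the trace of the k-th power of the monodromy matrix M.  By Cayley–Hamilton
-- s (k+2) = s 1 · s (k+1) - s k, and positivity of the entries forces s 1 ≥ 2.  Hence either all s k
-- are 2 or all s k with k > 0 exceed 2.
--
-- A triangulation of the punctured disc gives a positive periodic solution p of the recurrence: p i = 1
-- when the puncture is joined to i, and p i = p l + p r when l i r is the triangle of the triangulation
-- with i on the side of the arc l r away from the puncture.  So M has eigenvalue 1, and its trace is 2.
--
-- Conversely, if the trace is 2, then w = v n - v 0 is fixed by M and p i = det (v i) w is a positive
-- periodic solution of the recurrence.  Let g be the greatest common divisor of its values.  The arcs
-- i j with D i j = 1, and the arcs joining i with p i = g to the puncture, form a triangulation: they
-- do not cross by Ptolemy's relation, and any other arc crosses one of them, because if D i k = 1 then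
-- v k - v i, up to sign, is again some v l, unless p i = p k = g.  Ptolemy's relation also gives
-- p i = p l + p r for the triangles of this triangulation, so the numbers of regions satisfy the same
-- recurrence for p as the quiddity row, and therefore agree with it.
module Submission where

open import Data.Bool.Base using (if_then_else_)
open import Data.Empty using (⊥; ⊥-elim)
open import Data.Fin.Base as Fin using (Fin; toℕ; fromℕ<)
import Data.Fin.Properties as Fin
open import Data.Integer.Base hiding (suc; pred; positive)
open import Data.Integer.DivMod using (_/ℕ_; a≡a%ℕn+[a/ℕn]*n; n%ℕd<d)
open import Data.Integer.Properties
open import Data.Integer.Tactic.RingSolver using (solve; solve-∀)
open import Data.List.Base
  using (List; []; _∷_; map; downFrom; length; filter; concatMap; allFin; upTo; deduplicate)
open import Data.List.Membership.Propositional using (_∈_; find; lose)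
open import Data.List.Membership.Propositional.Properties
  using (∈-deduplicate⁺; ∈-deduplicate⁻; ∈-filter⁺; ∈-filter⁻; ∈-concatMap⁺; ∈-allFin; ∈-upTo⁺)
open import Data.List.Relation.Unary.All as All using (All)
import Data.List.Relation.Unary.AllPairs as AllPairs
open import Data.List.Relation.Unary.Any using (Any; here; there; any?)
open import Data.List.Relation.Unary.Unique.DecPropositional.Properties using (deduplicate-!)
open import Data.List.Relation.Unary.Unique.Propositional using (Unique)
open import Data.Nat.Base as ℕ using (ℕ; zero; suc)
import Data.Nat.Divisibility as ℕ
open import Data.Nat.DivMod using (_mod_; m≡m%n+[m/n]*n; m%n<n)
open import Data.Nat.GCD using (gcd; gcd[m,n]∣m; gcd[m,n]∣n; gcd-greatest; gcd[m,n]≢0)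
open import Data.Nat.ListAction using (sum)
import Data.Nat.Properties as ℕ
import Data.Nat.Tactic.RingSolver as ℕRing
open import Data.Product.Base using (∃-syntax; _×_; _,_; proj₁; proj₂)
open import Data.Sum.Base using (_⊎_; inj₁; inj₂)
open import Function.Base using (_∘_)
open import Function.Bundles using (_⇔_; mk⇔; Equivalence)
open import Relation.Binary.Definitions using (DecidableEquality; Tri; tri<; tri≈; tri>)
open import Relation.Binary.PropositionalEquality
open import Relation.Nullary.Decidable
  using (Dec; yes; no; does; does-⇔; map′; _×-dec_; decidable-stable)
open import Relation.Nullary.Negation using (contradiction)
open import Relation.Nullary.Negation.Core using (¬_)
open import Relation.Unary using (Decidable)
open import Defs

-- Inequalities are proved by writing j - i (for ≤), j - (1 + i) (for <) or -1 (for ⊥) as a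
-- combination of nonnegative terms by sums and products; the ring solver checks the identity.

infixl 6 _⊕_
infixl 7 _⊗_

_⊕_ : ∀ {i j} → 0ℤ ≤ i → 0ℤ ≤ j → 0ℤ ≤ i + j
p ⊕ q = +-mono-≤ p q

_⊗_ : ∀ {i j} → 0ℤ ≤ i → 0ℤ ≤ j → 0ℤ ≤ i * j
_⊗_ {i} {j} p q = subst (_≤ i * j) (*-zeroʳ i) (*-monoˡ-≤-nonNeg i {{nonNegative p}} q)

gap : ∀ {i j} → i ≤ j → 0ℤ ≤ j - i
gap = i≤j⇒0≤j-i

gap< : ∀ {i j} → i < j → 0ℤ ≤ j - (1ℤ + i)
gap< p = gap (i<j⇒suc[i]≤j p)

gap≡ : ∀ {i j} → i ≡ j → 0ℤ ≤ j - i
gap≡ p = gap (≤-reflexive p)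

≤-by : ∀ {e i j} → 0ℤ ≤ e → e ≡ j - i → i ≤ j
≤-by p eq = 0≤i-j⇒j≤i (subst (0ℤ ≤_) eq p)

<-by : ∀ {e i j} → 0ℤ ≤ e → e ≡ j - (1ℤ + i) → i < j
<-by p eq = suc[i]≤j⇒i<j (≤-by p eq)

⊥-by : ∀ {e} {A : Set} → 0ℤ ≤ e → e ≡ -1ℤ → A
⊥-by p eq with () ← subst (0ℤ ≤_) eq p

≡-by : ∀ {x y i j} → x ≡ y → x - y ≡ i - j → i ≡ j
≡-by {i = i} {j} p eq = i-j≡0⇒i≡j i j (trans (sym eq) (i≡j⇒i-j≡0 p))

0≤+ : ∀ n → 0ℤ ≤ + n
0≤+ n = +≤+ ℕ.z≤n

offset : ∀ {i j} → i ≤ j → ∃[ ℓ ] j ≡ i + + ℓ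
offset {i} {j} p = ∣ j - i ∣ ,
  sym (≡-by (0≤i⇒+∣i∣≡i (gap p)) (lem (+ ∣ j - i ∣) i j))
  where
  lem : ∀ a i j → a - (j - i) ≡ (i + a) - j
  lem = solve-∀

offset-≤ : ∀ i {m n} → i + + m ≤ i + + n → m ℕ.≤ n
offset-≤ i {m} {n} p = drop‿+≤+ (≤-by (gap p) (lem i (+ m) (+ n)))
  where
  lem : ∀ i x y → i + y - (i + x) ≡ y - x
  lem = solve-∀

offset-< : ∀ i {m n} → i + + m < i + + n → m ℕ.< n
offset-< i {m} {n} p = drop‿+<+ (<-by (gap< p) (lem i (+ m) (+ n)))
  where
  lem : ∀ i x y → i + y - (1ℤ + (i + x)) ≡ y - (1ℤ + x)
  lem = solve-∀

-- Indicators and finite sums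

ind : ∀ {P : Set} → Dec P → ℕ
ind P? = if does P? then 1 else 0

ind-yes : ∀ {P : Set} (P? : Dec P) → P → ind P? ≡ 1
ind-yes (yes _) _ = refl
ind-yes (no ¬p) p = contradiction p ¬p

ind-no : ∀ {P : Set} (P? : Dec P) → ¬ P → ind P? ≡ 0
ind-no (yes p) ¬p = contradiction p ¬p
ind-no (no _) _ = refl

ind-cong : ∀ {P Q : Set} (P? : Dec P) (Q? : Dec Q) → (P → Q) → (Q → P) → ind P? ≡ ind Q?
ind-cong P? (yes q) f g = ind-yes P? (g q)
ind-cong P? (no ¬q) f g = ind-no P? (¬q ∘ f)

∑ : ℕ → (ℕ → ℕ) → ℕ
∑ n f = sum (map f (downFrom n))

∑-cong : ∀ n {f g : ℕ → ℕ} → (∀ ℓ → f ℓ ≡ g ℓ) → ∑ n f ≡ ∑ n g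
∑-cong zero    h = refl
∑-cong (suc n) h = cong₂ ℕ._+_ (h n) (∑-cong n h)

-- Triangulations of the universal cover

-- The lift to ℤ of a triangulation of the punctured disc: A i j says that i and j are joined by an
-- arc, C c that c is joined to the puncture.
record PeriodicTriangulation (N : ℕ) : Set₁ where
  field
    A         : ℤ → ℤ → Set
    C         : ℤ → Set
    A?        : ∀ i j → Dec (A i j)
    C?        : ∀ c → Dec (C c)
    A-long    : ∀ {i j} → A i j → i + + 2 ≤ j
    A-short   : ∀ {i j} → A i j → j ≤ i + + N
    A-shift   : ∀ {i j} → A i j → A (i + + N) (j + + N)
    A-unshift : ∀ {i j} → A (i + + N) (j + + N) → A i j
    C-shift   : ∀ {c} → C c → C (c + + N)
    C-unshift : ∀ {c} → C (c + + N) → C c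
    A∦A       : ∀ {i j k l} → A i j → A k l → i < k → k < j → j < l → ⊥
    A∦C       : ∀ {i j c} → A i j → C c → i < c → c < j → ⊥
    A-maximal : ∀ {i j} → i + + 2 ≤ j → j ≤ i + + N →
                (∀ {k l} → A k l → i < k → k < j → j < l → ⊥) →
                (∀ {k l} → A k l → k < i → i < l → l < j → ⊥) →
                (∀ {c} → C c → i < c → c < j → ⊥) → A i j
    C-maximal : ∀ {c} → (∀ {k l} → A k l → k < c → c < l → ⊥) → C c

-ˡ<⇒-ʳ< : ∀ {i j} → - i < j → - j < i
-ˡ<⇒-ʳ< {i} {j} p = <-by (gap< p) (solve (i ∷ j ∷ []))

<-ˡ⇒<-ʳ : ∀ {i j} → i < - j → j < - i
<-ˡ⇒<-ʳ {i} {j} p = <-by (gap< p) (solve (i ∷ j ∷ []))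

-- Reflection `i ↦ - i` exchanges left and right, so what is proved about right neighbours carries
-- over to left neighbours.
mirror : ∀ {N} → PeriodicTriangulation N → PeriodicTriangulation N
mirror {N} S = record
  { A         = λ i j → A (- j) (- i)
  ; C         = λ c → C (- c)
  ; A?        = λ i j → A? (- j) (- i)
  ; C?        = λ c → C? (- c)
  ; A-long    = λ {i} {j} a → ≤-by (gap (A-long a)) (long i j (+ 2))
  ; A-short   = λ {i} {j} a → ≤-by (gap (A-short a)) (short i j (+ N))
  ; A-shift   = λ {i} {j} a → A-unshift (subst₂ A (-+- j (+ N)) (-+- i (+ N)) a)
  ; A-unshift = λ {i} {j} a → subst₂ A (-++ j (+ N)) (-++ i (+ N)) (A-shift a)
  ; C-shift   = λ {c} a → C-unshift (subst C (-+- c (+ N)) a)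
  ; C-unshift = λ {c} a → subst C (-++ c (+ N)) (C-shift a)
  ; A∦A       = λ a b p q r → A∦A b a (neg-mono-< r) (neg-mono-< q) (neg-mono-< p)
  ; A∦C       = λ a c p q → A∦C a c (neg-mono-< q) (neg-mono-< p)
  ; A-maximal = λ {i} {j} p q f g h → A-maximal
      (≤-by (gap p) (long′ i j (+ 2))) (≤-by (gap q) (short′ i j (+ N)))
      -- Arcs crossing over the right end become arcs crossing over the left end, so the two
      -- crossing hypotheses are swapped.
      (λ a u v w → g (neg² a) (-ˡ<⇒-ʳ< w) (<-ˡ⇒<-ʳ v) (-ˡ<⇒-ʳ< u))
      (λ a u v w → f (neg² a) (<-ˡ⇒<-ʳ w) (-ˡ<⇒-ʳ< v) (<-ˡ⇒<-ʳ u))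
      (λ {c} d u v → h (subst C (sym (neg-involutive c)) d) (<-ˡ⇒<-ʳ v) (-ˡ<⇒-ʳ< u))
  ; C-maximal = λ {c} h → C-maximal (λ a u v → h (neg² a) (-ˡ<⇒-ʳ< v) (<-ˡ⇒<-ʳ u))
  }
  where
  open PeriodicTriangulation S

  long : ∀ i j d → - i - (- j + d) ≡ j - (i + d)
  long = solve-∀
  short : ∀ i j d → - j + d - - i ≡ i + d - j
  short = solve-∀
  long′ : ∀ i j d → j - (i + d) ≡ - i - (- j + d)
  long′ = solve-∀
  short′ : ∀ i j d → i + d - j ≡ - j + d - - i
  short′ = solve-∀
  -+- : ∀ i d → - i ≡ - (i + d) + d
  -+- = solve-∀
  -++ : ∀ i d → - (i + d) + d ≡ - i
  -++ = solve-∀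
  neg² : ∀ {i j} → A i j → A (- - i) (- - j)
  neg² {i} {j} = subst₂ A (sym (neg-involutive i)) (sym (neg-involutive j))

-- Edges and triangles at a point

module Neighbours {N : ℕ} (1≤N : 1 ℕ.≤ N) (S : PeriodicTriangulation N) where
  open PeriodicTriangulation S

  -- Arcs and boundary segments.
  E : ℤ → ℤ → Set
  E i j = j ≡ i + 1ℤ ⊎ A i j

  A⇒< : ∀ {i j} → A i j → i < j
  A⇒< {i} {j} a = <-by (gap (A-long a) ⊕ 0≤+ 1) (solve (i ∷ j ∷ []))

  E⇒< : ∀ {i j} → E i j → i < j
  E⇒< {i} (inj₁ refl) = <-by (0≤+ 0) (solve (i ∷ []))
  E⇒< (inj₂ a)    = A⇒< a

  E-short : ∀ {i j} → E i j → j ≤ i + + N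
  E-short {i} (inj₁ refl) = +-monoʳ-≤ i (+≤+ 1≤N)
  E-short (inj₂ a)        = A-short a

  no-between : ∀ {i k} {B : Set} → i < k → k < i + 1ℤ → B
  no-between {i} {k} p q = ⊥-by (gap< p ⊕ gap< q) (solve (i ∷ k ∷ []))

  E∦A : ∀ {i j k l} → E i j → A k l → i < k → k < j → j < l → ⊥
  E∦A (inj₁ refl) b p q r = no-between p q
  E∦A (inj₂ a)    b p q r = A∦A a b p q r

  A∦E : ∀ {i j k l} → A i j → E k l → i < k → k < j → j < l → ⊥
  A∦E a (inj₁ refl) p q r = no-between q r
  A∦E a (inj₂ b)    p q r = A∦A a b p q r

  E∦E : ∀ {i j k l} → E i j → E k l → i < k → k < j → j < l → ⊥
  E∦E (inj₁ refl) b p q r = no-between p q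
  E∦E (inj₂ a)    b p q r = A∦E a b p q r

  E-shift : ∀ {i j} → E i j → E (i + + N) (j + + N)
  E-shift {i} (inj₁ refl) = inj₁ (lem i (+ N))
    where
    lem : ∀ i d → i + 1ℤ + d ≡ i + d + 1ℤ
    lem = solve-∀
  E-shift (inj₂ a)        = inj₂ (A-shift a)

  E∦C : ∀ {i j c} → E i j → C c → i < c → c < j → ⊥
  E∦C (inj₁ refl) d p q = no-between p q
  E∦C (inj₂ a)    d p q = A∦C a d p q

  RightMost : ℤ → ℤ → Set
  RightMost i j = E i j × (∀ {b} → A i b → b ≤ j)

  LeftMost : ℤ → ℤ → Set
  LeftMost h i = E h i × (∀ {a} → A a i → h ≤ a)

  E-maximal : ∀ {i j} → i < j → j ≤ i + + N →
              (∀ {k l} → A k l → i < k → k < j → j < l → ⊥) →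
              (∀ {k l} → A k l → k < i → i < l → l < j → ⊥) →
              (∀ {c} → C c → i < c → c < j → ⊥) → E i j
  E-maximal {i} {j} i<j s f g h with j ≟ i + 1ℤ
  ... | yes eq = inj₁ eq
  ... | no  ne = inj₂ (A-maximal long s f g h)
    where
    i+1≤j : i + 1ℤ ≤ j
    i+1≤j = ≤-by (gap< i<j) (solve (i ∷ j ∷ []))
    long : i + + 2 ≤ j
    long = ≤-by (gap< (≤∧≢⇒< i+1≤j (ne ∘ sym))) (solve (i ∷ j ∷ []))

  -- An arc crossing `j k` would cross `i j` or `i k`, or else join `i` to a point strictly between
  -- `j` and `k`; so maximality makes `j k` an edge.
  consecutive : ∀ {i j k} → E i j → A i k → j < k →
                (∀ {b} → A i b → b < k → b ≤ j) → E j k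
  consecutive {i} {j} {k} e a j<k cons = E-maximal j<k short f g h
    where
    i<j = E⇒< e
    short : k ≤ j + + N
    short = ≤-trans (A-short a) (+-monoˡ-≤ (+ N) (<⇒≤ i<j))
    f : ∀ {x y} → A x y → j < x → x < k → k < y → ⊥
    f b p q r = A∦A a b (<-trans i<j p) q r
    g : ∀ {x y} → A x y → x < j → j < y → y < k → ⊥
    g {x} {y} b p q r with <-cmp x i
    ... | tri< x<i _ _ = A∦A b a x<i (<-trans i<j q) r
    ... | tri≈ _ refl _ = ≤⇒≯ (cons b r) q
    ... | tri> _ _ i<x = E∦A e b i<x p q
    h : ∀ {c} → C c → j < c → c < k → ⊥
    h d p q = A∦C a d (<-trans i<j p) q

  -- The outermost neighbours of a point i not joined to the puncture span a triangle with i; their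
  -- distance is at most N, since otherwise i would carry a loop, which separates it from all arcs
  -- passing over it, and i would be joined to the puncture by maximality.
  apex : ∀ {h i j} → LeftMost h i → RightMost i j → ¬ C i → A h j
  apex {h} {i} {j} (e , min) (e′ , max) ¬c = inj₂-of (E-maximal h<j short f g k)
    where
    h<i = E⇒< e
    i<j = E⇒< e′
    h<j = <-trans h<i i<j
    inj₂-of : E h j → A h j
    inj₂-of (inj₁ refl) = no-between h<i i<j
    inj₂-of (inj₂ a) = a
    f : ∀ {x y} → A x y → h < x → x < j → j < y → ⊥
    f {x} {y} b p q r with <-cmp x i
    ... | tri< x<i _ _ = E∦A e b p x<i (<-trans i<j r)
    ... | tri≈ _ refl _ = ≤⇒≯ (max b) r
    ... | tri> _ _ i<x = E∦A e′ b i<x q r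
    g : ∀ {x y} → A x y → x < h → h < y → y < j → ⊥
    g {x} {y} b p q r with <-cmp y i
    ... | tri< y<i _ _ = A∦E b e p q y<i
    ... | tri≈ _ refl _ = ≤⇒≯ (min b) p
    ... | tri> _ _ i<y = A∦E b e′ (<-trans p h<i) i<y r
    k : ∀ {c} → C c → h < c → c < j → ⊥
    k {c} d p q with <-cmp c i
    ... | tri< c<i _ _ = E∦C e d p c<i
    ... | tri≈ _ refl _ = ¬c d
    ... | tri> _ _ i<c = E∦C e′ d i<c q
    ¬loop : ¬ E i (i + + N)
    -- An arc `x y` over `i` has `y ≤ x + N < i + N`, so it would cross the loop at `i`.
    ¬loop l = ¬c (C-maximal λ b p q →
      A∦E b l p q (≤-<-trans (A-short b) (+-monoˡ-< (+ N) p)))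
    j≢i+N : j ≢ i + + N
    j≢i+N eq = ¬loop (subst (E i) eq e′)
    i≢h+N : i ≢ h + + N
    i≢h+N eq = ¬loop (subst (λ z → E z (i + + N)) (sym eq) (E-shift e))
    short : j ≤ h + + N
    short with j ≤? h + + N
    ... | yes p = p
    -- If `h + N < j`, the translate of the edge `h i` runs from `h + N`, inside `i j`, to `i + N`,
    -- beyond `j`. The absence of loops makes these inequalities strict.
    ... | no  p = ⊥-elim (E∦E e′ (E-shift e) (≤∧≢⇒< (E-short e) i≢h+N) (≰⇒> p)
                    (≤∧≢⇒< (E-short e′) j≢i+N))

  -- An arc over `j` would pass over the central point `i`, or start at `i` and reach beyond its
  -- rightmost neighbour, or cross the edge `i j`.
  C-next : ∀ {i j} → RightMost i j → C i → C j
  C-next {i} {j} (e , max) c = C-maximal f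
    where
    f : ∀ {x y} → A x y → x < j → j < y → ⊥
    f {x} {y} b p q with <-cmp x i
    ... | tri< x<i _ _ = A∦C b c x<i (<-trans (E⇒< e) q)
    ... | tri≈ _ refl _ = ≤⇒≯ (max b) q
    ... | tri> _ _ i<x = E∦A e b i<x p q

  -- The default 1 stands for the boundary segment: without arcs to the right, the rightmost
  -- neighbour of `i` is `i + 1`.
  lastUpTo : {P : ℕ → Set} → (∀ ℓ → Dec (P ℓ)) → ℕ → ℕ
  lastUpTo P? zero    = 1
  lastUpTo P? (suc n) = if does (P? (suc n)) then suc n else lastUpTo P? n

  lastUpTo-≤ : {P : ℕ → Set} (P? : ∀ ℓ → Dec (P ℓ)) → ∀ n → 1 ℕ.≤ n → lastUpTo P? n ℕ.≤ n
  lastUpTo-≤ P? (suc n) _ with P? (suc n)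
  ... | yes _ = ℕ.≤-refl
  lastUpTo-≤ P? (suc zero)    _ | no _ = ℕ.≤-refl
  lastUpTo-≤ P? (suc (suc n)) _ | no _ = ℕ.m≤n⇒m≤1+n (lastUpTo-≤ P? (suc n) (ℕ.s≤s ℕ.z≤n))

  rightUpTo : ℤ → ℕ → ℕ
  rightUpTo i = lastUpTo (λ ℓ → A? i (i + + ℓ))

  R : ℤ → ℤ
  R i = i + + rightUpTo i N

  rightEnds : ℤ → ℕ → ℕ
  rightEnds i n = ∑ (suc n) (λ ℓ → ind (A? i (i + + ℓ)))

  -- The invariant of the search for the rightmost neighbour once all lengths up to `n` have been
  -- tried.
  record RightUpTo (i : ℤ) (n : ℕ) (j : ℤ) : Set where
    field
      edge : E i j
      last : ∀ {ℓ} → A i (i + + ℓ) → ℓ ℕ.≤ n → i + + ℓ ≤ j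

  ¬A₀ : ∀ {i} → ¬ A i (i + + 0)
  ¬A₀ {i} a = ⊥-by (gap (A-long a) ⊕ 0≤+ 1) (solve (i ∷ []))

  rightUpTo-spec : ∀ i n → RightUpTo i n (i + + rightUpTo i n)
  rightUpTo-spec i zero =
    record { edge = inj₁ refl ; last = λ { {zero} a _ → contradiction a ¬A₀ } }
  rightUpTo-spec i (suc n) with rightUpTo-spec i n | A? i (i + + suc n)
  ... | rec | yes a = record { edge = inj₂ a ; last = λ _ q → +-monoʳ-≤ i (+≤+ q) }
  ... | rec | no ¬a = record { edge = edge ; last = last′ }
    where
    open RightUpTo rec
    last′ : ∀ {ℓ} → A i (i + + ℓ) → ℓ ℕ.≤ suc n → i + + ℓ ≤ i + + rightUpTo i n
    last′ {ℓ} b q with ℕ.m≤n⇒m<n∨m≡n q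
    ... | inj₁ (ℕ.s≤s q′) = last b q′
    ... | inj₂ refl = contradiction b ¬a

  module _ (p : ℤ → ℤ)
           (p-triangle : ∀ {l i r} → E l i → E i r → A l r → p i ≡ p l + p r)
           (i : ℤ)
    where

    -- When an arc `i k` follows the neighbour `j` of `i`, the triangle `i j k` gives
    -- `p j = p i + p k`: the last neighbour moves from `j` to `k` at the cost of one more `p i`.
    rightWalk : ∀ n → p (i + 1ℤ) ≡ + rightEnds i n * p i + p (i + + rightUpTo i n)
    rightWalk zero =
      trans (base (p i) (p (i + 1ℤ)))
            (cong (λ z → + (z ℕ.+ 0) * p i + p (i + 1ℤ)) (sym (ind-no (A? i (i + + 0)) ¬A₀)))
      where
      base : ∀ a b → b ≡ + 0 * a + b
      base = solve-∀
    rightWalk (suc n) with rightWalk n | A? i (i + + suc n)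
    ... | eq | no  _ = eq
    ... | eq | yes a =
      trans eq (trans (cong (λ z → + rightEnds i n * p i + z) (p-triangle edge step a))
                      (arith (+ rightEnds i n) (p i) (p (i + + suc n))))
      where
      open RightUpTo (rightUpTo-spec i n)
      arith : ∀ c x y → c * x + (x + y) ≡ (1ℤ + c) * x + y
      arith = solve-∀
      -- An arc has length at least 2, so `n` is not 0, where the default 1 would exceed `n`.
      1≤n : 1 ℕ.≤ n
      1≤n = ℕ.≤-pred (offset-≤ i (A-long a))
      before : i + + rightUpTo i n < i + + suc n
      before = +-monoʳ-< i (+<+ (ℕ.s≤s (lastUpTo-≤ _ n 1≤n)))
      cons : ∀ {b} → A i b → b < i + + suc n → b ≤ i + + rightUpTo i n
      cons {b} a′ q with offset (<⇒≤ (A⇒< a′))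
      ... | ℓ , refl = last a′ (ℕ.≤-pred (offset-< i q))
      step : E (i + + rightUpTo i n) (i + + suc n)
      step = consecutive edge a before cons

  R-rightmost : ∀ i → RightMost i (R i)
  R-rightmost i = edge , max
    where
    open RightUpTo (rightUpTo-spec i N)
    max : ∀ {b} → A i b → b ≤ R i
    max {b} a with offset (<⇒≤ (A⇒< a))
    ... | ℓ , refl = last a (offset-≤ i (A-short a))

  lastUpTo-cong : ∀ {P Q : ℕ → Set} (P? : ∀ ℓ → Dec (P ℓ)) (Q? : ∀ ℓ → Dec (Q ℓ)) →
                  (∀ ℓ → P ℓ ⇔ Q ℓ) → ∀ n → lastUpTo P? n ≡ lastUpTo Q? n
  lastUpTo-cong P? Q? eqv zero    = refl
  lastUpTo-cong P? Q? eqv (suc n) = cong₂ (λ b x → if b then suc n else x)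
    (does-⇔ (eqv (suc n)) (P? (suc n)) (Q? (suc n))) (lastUpTo-cong P? Q? eqv n)

  R-shift : ∀ i → R (i + + N) ≡ R i + + N
  R-shift i = trans
    (cong (λ x → i + + N + + x) (lastUpTo-cong _ _ shift N))
    (swap i (+ N) (+ rightUpTo i N))
    where
    swap : ∀ i d x → i + d + x ≡ i + x + d
    swap = solve-∀
    shift : ∀ ℓ → A (i + + N) (i + + N + + ℓ) ⇔ A i (i + + ℓ)
    shift ℓ = mk⇔ (A-unshift ∘ subst (A (i + + N)) (swap i (+ N) (+ ℓ)))
                  (subst (A (i + + N)) (sym (swap i (+ N) (+ ℓ))) ∘ A-shift)

-- Sums over all neighbours and the positive periodic solution

module Ends {N : ℕ} (1≤N : 1 ℕ.≤ N) (S : PeriodicTriangulation N) where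
  open PeriodicTriangulation S
  open Neighbours 1≤N S public
  module M = Neighbours 1≤N (mirror S)

  leftEnds : ℤ → ℕ → ℕ
  leftEnds i n = ∑ (suc n) (λ ℓ → ind (A? (i - + ℓ) i))

  ends : ℤ → ℕ
  ends i = rightEnds i N ℕ.+ leftEnds i N ℕ.+ ind (C? i)

  L : ℤ → ℤ
  L i = - M.R (- i)

  unmirrorE : ∀ {i j} → M.E i j → E (- j) (- i)
  unmirrorE {i} (inj₁ refl) = inj₁ (lem i)
    where
    lem : ∀ i → - i ≡ - (i + 1ℤ) + 1ℤ
    lem = solve-∀
  unmirrorE (inj₂ a)        = inj₂ a

  L-leftmost : ∀ i → LeftMost (L i) i
  L-leftmost i with M.R-rightmost (- i)
  ... | e , max = subst (E (L i)) (neg-involutive i) (unmirrorE e) , min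
    where
    min : ∀ {a} → A a i → L i ≤ a
    min {a} b = subst (L i ≤_) (neg-involutive a)
      (neg-mono-≤ (max (subst₂ A (sym (neg-involutive a)) (sym (neg-involutive i)) b)))

  -- Kept general to serve both directions: for the solution built from a triangulation, with
  -- `g = 1`, and for the determinants `p` of a polygon.
  module Values (p : ℤ → ℤ) (g : ℤ) (p-central : ∀ {i} → C i → p i ≡ g)
    (p-triangle : ∀ {l i r} → E l i → E i r → A l r → p i ≡ p l + p r)
    where

    right-sum : ∀ i → p (i + 1ℤ) ≡ + rightEnds i N * p i + p (R i)
    right-sum i = rightWalk p p-triangle i N

    left-sum : ∀ i → p (i - 1ℤ) ≡ + leftEnds i N * p i + p (L i)
    left-sum i = subst₂ (λ x y → p x ≡ + leftEnds i N * p y + p (L i)) (lem₁ i) (neg-involutive i)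
      (trans (M.rightWalk (λ j → p (- j)) triangle′ (- i) N)
             (cong (λ z → + z * p (- - i) + p (L i)) (∑-cong (suc N) λ ℓ →
               ind-cong (A? (- (- i + + ℓ)) (- - i)) (A? (i - + ℓ) i)
                 (subst₂ A (lem₂ i (+ ℓ)) (neg-involutive i))
                 (subst₂ A (sym (lem₂ i (+ ℓ))) (sym (neg-involutive i))))))
      where
      lem₁ : ∀ i → - (- i + 1ℤ) ≡ i - 1ℤ
      lem₁ = solve-∀
      lem₂ : ∀ i d → - (- i + d) ≡ i - d
      lem₂ = solve-∀
      triangle′ : ∀ {l i r} → M.E l i → M.E i r → A (- r) (- l) → p (- i) ≡ p (- l) + p (- r)
      triangle′ {l} {i} {r} e e′ a =
        trans (p-triangle (unmirrorE e′) (unmirrorE e) a) (+-comm (p (- r)) (p (- l)))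

    -- Summing p j = p i + p k over the triangles i j k on either side of i gives p (i ± 1); the last
    -- triangle, or else the arc to the puncture, accounts for the remaining 1 + [C i].
    neighbour-sum : ∀ i → p (i - 1ℤ) + p (i + 1ℤ) ≡ + suc (ends i) * p i
    neighbour-sum i = trans (cong₂ _+_ (left-sum i) (right-sum i)) (finish (C? i))
      where
      x = + leftEnds i N
      y = + rightEnds i N
      at-central : ∀ x y z → x * z + z + (y * z + z) ≡ (1ℤ + (y + x + 1ℤ)) * z
      at-central = solve-∀
      off-central : ∀ x y u v → x * (u + v) + u + (y * (u + v) + v) ≡ (1ℤ + (y + x + 0ℤ)) * (u + v)
      off-central = solve-∀
      finish : (c? : Dec (C i)) →
        x * p i + p (L i) + (y * p i + p (R i)) ≡
        + suc (rightEnds i N ℕ.+ leftEnds i N ℕ.+ ind c?) * p i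
      -- At a central point both outermost neighbours are central, so `p (L i)` and `p (R i)` equal
      -- `p i`; elsewhere they span a triangle with `i` and their values sum to `p i`.
      finish (yes c) = trans
        (cong₂ (λ u v → x * p i + u + (y * p i + v)) (same left) (same right)) (at-central x y (p i))
        where
        same : ∀ {j} → C j → p j ≡ p i
        same d = trans (p-central d) (sym (p-central c))
        right : C (R i)
        right = C-next (R-rightmost i) c
        left : C (L i)
        left = M.C-next (M.R-rightmost (- i)) (subst C (sym (neg-involutive i)) c)
      finish (no ¬c) = subst
        (λ z → x * z + p (L i) + (y * z + p (R i)) ≡ (1ℤ + (y + x + 0ℤ)) * z)
        (sym (p-triangle (proj₁ (L-leftmost i)) (proj₁ (R-rightmost i))
               (apex (L-leftmost i) (R-rightmost i) ¬c)))
        (off-central x y (p (L i)) (p (R i)))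

  L-shift : ∀ i → L (i + + N) ≡ L i + + N
  L-shift i = trans (lem (M.R (- (i + + N))) (+ N)) (cong (λ z → - z + + N)
    (trans (sym (M.R-shift (- (i + + N)))) (cong M.R (lem′ i (+ N)))))
    where
    lem : ∀ x d → - x ≡ - (x + d) + d
    lem = solve-∀
    lem′ : ∀ i d → - (i + d) + d ≡ - i
    lem′ = solve-∀

  L<R : ∀ i → L i < R i
  L<R i = <-trans (E⇒< (proj₁ (L-leftmost i))) (E⇒< (proj₁ (R-rightmost i)))

  -- A recursion on fuel. The value 1 without fuel is positive and already correct at central
  -- points.
  value : ℕ → ℤ → ℤ
  value zero    i = 1ℤ
  value (suc k) i = if does (C? i) then 1ℤ else value k (L i) + value k (R i)

  value-positive : ∀ k i → 0ℤ < value k i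
  value-positive zero    i = +<+ (ℕ.s≤s ℕ.z≤n)
  value-positive (suc k) i with C? i
  ... | yes _ = +<+ (ℕ.s≤s ℕ.z≤n)
  ... | no  _ = +-mono-< (value-positive k (L i)) (value-positive k (R i))

  value-shift : ∀ k i → value k (i + + N) ≡ value k i
  value-shift zero    i = refl
  value-shift (suc k) i = cong₂ (λ b x → if b then 1ℤ else x)
    (does-⇔ (mk⇔ C-unshift C-shift) (C? (i + + N)) (C? i))
    (cong₂ _+_ (trans (cong (value k) (L-shift i)) (value-shift k (L i)))
               (trans (cong (value k) (R-shift i)) (value-shift k (R i))))

  -- For i not central the arc from L i to R i has length at most N, and this
  -- length grows strictly along the recursion, so N steps of it suffice.
  value-stable : ∀ k i → L i + + N < R i + + k → value (suc k) i ≡ value k i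
  value-stable k i q with C? i
  value-stable zero    i q | yes _ = refl
  -- Without fuel, the hypothesis makes the arc from `L i` to `R i` longer than `N`.
  value-stable zero    i q | no ¬c =
    contradiction q (≤⇒≯ (subst (_≤ L i + + N) (sym (+-identityʳ (R i))) (A-short
      (apex (L-leftmost i) (R-rightmost i) ¬c))))
  value-stable (suc k) i q | yes c = stop (C? i)
    where
    stop : (c? : Dec (C i)) → 1ℤ ≡ (if does c? then 1ℤ else value k (L i) + value k (R i))
    stop (yes _) = refl
    stop (no ¬c) = contradiction c ¬c
  value-stable (suc k) i q | no ¬c = go (C? i)
    where
    l = L i
    r = R i
    a : A l r
    a = apex (L-leftmost i) (R-rightmost i) ¬c
    left : L l + + N < R l + + k
    left = bound (L l) (R l) l r (+ N) (+ k) q (E⇒< (proj₁ (L-leftmost l))) (proj₂ (R-rightmost l) a)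
      where
      bound : ∀ x y l r N k → l + N < r + (1ℤ + k) → x < l → r ≤ y → x + N < y + k
      bound x y l r N k p q s = <-by (gap< p ⊕ gap< q ⊕ gap s) (solve (x ∷ y ∷ l ∷ r ∷ N ∷ k ∷ []))
    right : L r + + N < R r + + k
    right = bound (L r) (R r) l r (+ N) (+ k) q (proj₂ (L-leftmost r) a) (E⇒< (proj₁ (R-rightmost r)))
      where
      bound : ∀ x y l r N k → l + N < r + (1ℤ + k) → x ≤ l → r < y → x + N < y + k
      bound x y l r N k p q s = <-by (gap< p ⊕ gap q ⊕ gap< s) (solve (x ∷ y ∷ l ∷ r ∷ N ∷ k ∷ []))
    go : (c? : Dec (C i)) → value (suc k) l + value (suc k) r ≡
         (if does c? then 1ℤ else value k l + value k r)
    go (yes c) = contradiction c ¬c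
    go (no _)  = cong₂ _+_ (value-stable k l left) (value-stable k r right)

  p : ℤ → ℤ
  p = value N

  p-unfold : ∀ i → p i ≡ value (suc N) i
  p-unfold i = sym (value-stable N i (+-monoˡ-< (+ N) (L<R i)))

  p-central : ∀ {i} → C i → p i ≡ 1ℤ
  p-central {i} c = trans (p-unfold i) (go (C? i))
    where
    go : (c? : Dec (C i)) → (if does c? then 1ℤ else p (L i) + p (R i)) ≡ 1ℤ
    go (yes _) = refl
    go (no ¬c) = contradiction c ¬c

  -- Since `l r` passes over `i`, the point is not central; and an edge from `i` leading beyond `l`
  -- or `r` would cross `l r`, so `l` and `r` are the outermost neighbours.
  p-triangle : ∀ {l i r} → E l i → E i r → A l r → p i ≡ p l + p r
  p-triangle {l} {i} {r} e e′ a = trans (p-unfold i) (trans (go (C? i)) (cong₂ (λ x y → p x + p y) L≡l R≡r))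
    where
    go : (c? : Dec (C i)) → (if does c? then 1ℤ else p (L i) + p (R i)) ≡ p (L i) + p (R i)
    go (yes c) = ⊥-elim (A∦C a c (E⇒< e) (E⇒< e′))
    go (no _)  = refl
    R≡r : R i ≡ r
    R≡r with R-rightmost i
    ... | f , max = ≤-antisym (≮⇒≥ λ q → A∦E a f (E⇒< e) (E⇒< e′) q) (E≤ e′)
      where
      E≤ : ∀ {j} → E i j → j ≤ R i
      E≤ (inj₁ refl) = ≮⇒≥ (no-between (E⇒< f))
      E≤ (inj₂ b)    = max b
    L≡l : L i ≡ l
    L≡l with L-leftmost i
    ... | f , min = ≤-antisym (E≤ e) (≮⇒≥ λ q → E∦A f a q (E⇒< e) (E⇒< e′))
      where
      E≤ : ∀ {j} → E j i → L i ≤ j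
      E≤ {j} (inj₁ refl) = ≮⇒≥ λ q → no-between q (E⇒< f)
      E≤ (inj₂ b)        = min b

  positive-periodic-solution : ∃[ p ] ((∀ i → 0ℤ < p i) × (∀ i → p (i + + N) ≡ p i) ×
    (∀ i → p (i - 1ℤ) + p (i + 1ℤ) ≡ + suc (ends i) * p i))
  positive-periodic-solution = p , value-positive N , value-shift N ,
    Values.neighbour-sum p 1ℤ p-central p-triangle

-- Triangulations of the punctured disc

module Residue (N : ℕ) .{{_ : ℕ.NonZero N}} where

  abstract
    res : ℤ → Fin N
    res i = fromℕ< (n%ℕd<d i N)

    quo : ℤ → ℤ
    quo i = i /ℕ N

    res+quo : ∀ i → i ≡ + toℕ (res i) + quo i * + N
    res+quo i = trans (a≡a%ℕn+[a/ℕn]*n i N)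
      (cong (λ z → + z + quo i * + N) (sym (Fin.toℕ-fromℕ< (n%ℕd<d i N))))

  -- Two remainders differ by less than `N` and cannot make up for different quotients.
  quotient-≮ : ∀ (x y : Fin N) k l → + toℕ x + k * + N ≡ + toℕ y + l * + N → ¬ k < l
  quotient-≮ x y k l eq k<l = lem (+ toℕ x) (+ toℕ y) k l (+ N) eq k<l (+<+ (Fin.toℕ<n x)) (0≤+ _) (0≤+ N)
    where
    lem : ∀ x y k l N → x + k * N ≡ y + l * N → k < l → x < N → 0ℤ ≤ y → 0ℤ ≤ N → ⊥
    lem x y k l N eq p q r s = ⊥-by (gap< q ⊕ r ⊕ gap< p ⊗ s ⊕ gap≡ (sym eq)) (solve (x ∷ y ∷ k ∷ l ∷ N ∷ []))

  res-unique : ∀ {i} x k → i ≡ + toℕ x + k * + N → res i ≡ x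
  res-unique {i} x k eq = Fin.toℕ-injective (+-injective (same (+ toℕ (res i)) (+ toℕ x) (quo i) k (+ N) quo≡ eq′))
    where
    eq′ : + toℕ (res i) + quo i * + N ≡ + toℕ x + k * + N
    eq′ = trans (sym (res+quo i)) eq
    quo≡ : quo i ≡ k
    quo≡ = ≤-antisym (≮⇒≥ (quotient-≮ x (res i) k (quo i) (sym eq′))) (≮⇒≥ (quotient-≮ (res i) x (quo i) k eq′))
    same : ∀ x y k l N → k ≡ l → x + k * N ≡ y + l * N → x ≡ y
    same x y k .k N refl eq = ≡-by eq (solve (x ∷ y ∷ k ∷ N ∷ []))

  res-shift : ∀ i → res (i + + N) ≡ res i
  res-shift i = res-unique (res i) (quo i + 1ℤ) (trans (cong (_+ + N) (res+quo i)) (lem (+ toℕ (res i)) (quo i) (+ N)))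
    where
    lem : ∀ x k N → x + k * N + N ≡ x + (k + 1ℤ) * N
    lem = solve-∀

  -- `boundaryEnds` records the right end of an arc as a remainder; this turns it into the condition
  -- on the left end that `Lifts` uses.
  res-mod : ∀ i y ℓ → res i ≡ (toℕ y ℕ.+ ℓ) mod N ⇔ y ≡ res (i - + ℓ)
  res-mod i y ℓ = mk⇔ to from
    where
    z = (toℕ y ℕ.+ ℓ) mod N
    q = + ((toℕ y ℕ.+ ℓ) ℕ./ N)
    eq : + toℕ y + + ℓ ≡ + toℕ z + q * + N
    eq = trans (cong +_ (trans (m≡m%n+[m/n]*n (toℕ y ℕ.+ ℓ) N)
           (cong (ℕ._+ (toℕ y ℕ.+ ℓ) ℕ./ N ℕ.* N) (sym (Fin.toℕ-fromℕ< (m%n<n (toℕ y ℕ.+ ℓ) N))))))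
         (cong (λ w → + toℕ z + w) (pos-* ((toℕ y ℕ.+ ℓ) ℕ./ N) N))
    to : res i ≡ z → y ≡ res (i - + ℓ)
    to e = sym (res-unique y (quo i - q) (lem (+ toℕ y) (+ ℓ) (+ toℕ z) q i (quo i) (+ N) eq
             (subst (λ r → i ≡ + toℕ r + quo i * + N) e (res+quo i))))
      where
      lem : ∀ y ℓ z q i k N → y + ℓ ≡ z + q * N → i ≡ z + k * N → i - ℓ ≡ y + (k - q) * N
      lem y ℓ z q i k N e refl = ≡-by (sym e) (solve (y ∷ ℓ ∷ z ∷ q ∷ k ∷ N ∷ []))
    from : y ≡ res (i - + ℓ) → res i ≡ z
    from refl = res-unique z (quo (i - + ℓ) + q) (lem (+ toℕ y) (+ ℓ) (+ toℕ z) q i (quo (i - + ℓ)) (+ N) eq (res+quo (i - + ℓ)))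
      where
      lem : ∀ y ℓ z q i k N → y + ℓ ≡ z + q * N → i - ℓ ≡ y + k * N → i ≡ z + (k + q) * N
      lem y ℓ z q i k N e e′ = ≡-by (cong₂ _+_ e e′) (solve (y ∷ ℓ ∷ z ∷ q ∷ i ∷ k ∷ N ∷ []))

module FromTriangulation {N : ℕ} {{nz : ℕ.NonZero N}} (T : Triangulation N) where
  open Residue N
  open Triangulation T

  1≤N : 1 ℕ.≤ N
  1≤N = ℕ.>-nonZero⁻¹ N

  Lifts : ℤ → ℤ → Arc N → Set
  Lifts i j (peripheral x ℓ _ _) = x ≡ res i × j ≡ i + + ℓ
  Lifts i j (central _)          = ⊥

  CentralAt : ℤ → Arc N → Set
  CentralAt c (peripheral _ _ _ _) = ⊥
  CentralAt c (central x)          = x ≡ res c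

  lifts? : ∀ i j → Decidable (Lifts i j)
  lifts? i j (peripheral x ℓ _ _) = (x Fin.≟ res i) ×-dec (j ≟ i + + ℓ)
  lifts? i j (central _)          = no λ ()

  centralAt? : ∀ c → Decidable (CentralAt c)
  centralAt? c (peripheral _ _ _ _) = no λ ()
  centralAt? c (central x)          = x Fin.≟ res c

  A : ℤ → ℤ → Set
  A i j = Any (Lifts i j) arcs

  C : ℤ → Set
  C c = Any (CentralAt c) arcs

  record Lift (i j : ℤ) : Set where
    constructor lift
    field
      {ℓ}  : ℕ
      2≤ℓ  : 2 ℕ.≤ ℓ
      ℓ≤N  : ℓ ℕ.≤ N
      mem  : peripheral (res i) ℓ 2≤ℓ ℓ≤N ∈ arcs
      end  : j ≡ i + + ℓ

  A⇒lift : ∀ {i j} → A i j → Lift i j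
  A⇒lift a with find a
  ... | peripheral _ _ p q , mem , refl , eq = lift p q mem eq

  lift⇒A : ∀ {i j x ℓ p q} k → peripheral x ℓ p q ∈ arcs →
           i ≡ + toℕ x + k * + N → j ≡ i + + ℓ → A i j
  lift⇒A {x = x} k mem e e′ = lose mem (sym (res-unique x k e) , e′)

  C⇒∈ : ∀ {c} → C c → central (res c) ∈ arcs
  C⇒∈ a with find a
  ... | central _ , mem , refl = mem

  ∈⇒C : ∀ {c x} k → central x ∈ arcs → c ≡ + toℕ x + k * + N → C c
  ∈⇒C {x = x} k mem e = lose mem (sym (res-unique x k e))

  A-short : ∀ {i j} → A i j → j ≤ i + + N
  A-short {i} a with A⇒lift a
  ... | lift p q mem refl = +-monoʳ-≤ i (+≤+ q)

  A-long : ∀ {i j} → A i j → i + + 2 ≤ j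
  A-long {i} a with A⇒lift a
  ... | lift p q mem refl = +-monoʳ-≤ i (+≤+ p)

  A-resp : ∀ {i j i′ j′} d → res i′ ≡ res i → i′ ≡ i + d → j′ ≡ j + d → A i j → A i′ j′
  A-resp {i} {j} {i′} {j′} d r e e′ a with A⇒lift a
  ... | lift {ℓ} p q mem refl = lose mem (sym r ,
    trans e′ (trans (lem i (+ ℓ) d) (cong (_+ + ℓ) (sym e))))
    where
    lem : ∀ i ℓ d → i + ℓ + d ≡ i + d + ℓ
    lem = solve-∀

  A-shift : ∀ {i j} → A i j → A (i + + N) (j + + N)
  A-shift {i} = A-resp (+ N) (res-shift i) refl refl

  A-unshift : ∀ {i j} → A (i + + N) (j + + N) → A i j
  A-unshift {i} {j} = A-resp (- + N) (sym (res-shift i)) (lem i (+ N)) (lem j (+ N))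
    where
    lem : ∀ i d → i ≡ i + d + - d
    lem = solve-∀

  C-shift : ∀ {c} → C c → C (c + + N)
  C-shift {c} a = lose (C⇒∈ a) (sym (res-shift c))

  C-unshift : ∀ {c} → C (c + + N) → C c
  C-unshift {c} a = lose (C⇒∈ a) (res-shift c)

  module _ (x y : ℤ) (k l : ℤ) where
    -- In `Cross` the first lift is fixed and only the second is translated, by the difference
    -- `l - k` of the quotients.
    start< : ∀ {i j} → i ≡ x + k * + N → j ≡ y + l * + N → i < j → x < y + (l - k) * + N
    start< refl refl p = lem (+ N) p
      where
      lem : ∀ N → x + k * N < y + l * N → x < y + (l - k) * N
      lem N p = <-by (gap< p) (solve (x ∷ y ∷ k ∷ l ∷ N ∷ []))

    end< : ∀ {i j} → i ≡ x + k * + N → j ≡ y + l * + N → j < i → y + (l - k) * + N < x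
    end< refl refl p = lem (+ N) p
      where
      lem : ∀ N → y + l * N < x + k * N → y + (l - k) * N < x
      lem N p = <-by (gap< p) (solve (x ∷ y ∷ k ∷ l ∷ N ∷ []))

    start<⁻¹ : ∀ {i j} → i ≡ x + k * + N → j ≡ y + (l + k) * + N → x < y + l * + N → i < j
    start<⁻¹ refl refl p = lem (+ N) p
      where
      lem : ∀ N → x < y + l * N → x + k * N < y + (l + k) * N
      lem N p = <-by (gap< p) (solve (x ∷ y ∷ k ∷ l ∷ N ∷ []))

    end<⁻¹ : ∀ {i j} → i ≡ x + k * + N → j ≡ y + (l + k) * + N → y + l * + N < x → j < i
    end<⁻¹ refl refl p = lem (+ N) p
      where
      lem : ∀ N → y + l * N < x → y + (l + k) * N < x + k * N
      lem N p = <-by (gap< p) (solve (x ∷ y ∷ k ∷ l ∷ N ∷ []))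

  end-eq : ∀ {i} x k ℓ → i ≡ x + k * + N → i + ℓ ≡ x + ℓ + k * + N
  end-eq x k ℓ refl = lem x k ℓ (+ N)
    where
    lem : ∀ x k ℓ N → x + k * N + ℓ ≡ x + ℓ + k * N
    lem = solve-∀

  A∦A : ∀ {i j k l} → A i j → A k l → i < k → k < j → j < l → ⊥
  A∦A {i} {_} {k} a b u v w with A⇒lift a | A⇒lift b
  ... | lift {ℓ} _ _ mem refl | lift {ℓ′} _ _ mem′ refl = noncrossing mem mem′
    (n - m , inj₁ (start< x y m n i≡ k≡ u ,
                   end< (x + + ℓ) y m n (end-eq x m (+ ℓ) i≡) k≡ v ,
                   start< (x + + ℓ) (y + + ℓ′) m n (end-eq x m (+ ℓ) i≡) (end-eq y n (+ ℓ′) k≡) w))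
    where
    x = + toℕ (res i)
    y = + toℕ (res k)
    m = quo i
    n = quo k
    i≡ = res+quo i
    k≡ = res+quo k

  A∦C : ∀ {i j c} → A i j → C c → i < c → c < j → ⊥
  A∦C {i} {_} {c} a b u v with A⇒lift a
  ... | lift {ℓ} _ _ mem refl = noncrossing mem (C⇒∈ b)
    (n - m , start< x y m n i≡ c≡ u ,
             end< (x + + ℓ) y m n (end-eq x m (+ ℓ) i≡) c≡ v)
    where
    x = + toℕ (res i)
    y = + toℕ (res c)
    m = quo i
    n = quo c
    i≡ = res+quo i
    c≡ = res+quo c

  A-maximal : ∀ {i j} → i + + 2 ≤ j → j ≤ i + + N →
              (∀ {k l} → A k l → i < k → k < j → j < l → ⊥) →
              (∀ {k l} → A k l → k < i → i < l → l < j → ⊥) →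
              (∀ {c} → C c → i < c → c < j → ⊥) → A i j
  A-maximal {i} {j} p q f g h with offset (≤-trans (i≤i+j i (+ 2)) p)
  ... | ℓ , refl = lose (maximal (peripheral (res i) ℓ 2≤ℓ ℓ≤N) nocross) (refl , refl)
    where
    2≤ℓ = offset-≤ i p
    ℓ≤N = offset-≤ i q
    x = + toℕ (res i)
    k = quo i
    i≡ = res+quo i
    nocross : ∀ {β} → β ∈ arcs → ¬ Cross (peripheral (res i) ℓ 2≤ℓ ℓ≤N) β
    -- The witness `m` is relative to the representative of `i`, which is `k` periods away from `i`;
    -- hence the translate by `m + k`.
    nocross {peripheral y ℓ′ _ _} mem (m , inj₁ (u , v , w)) =
      f {+ toℕ y + (m + k) * + N} (lift⇒A (m + k) mem refl refl)
        (start<⁻¹ x (+ toℕ y) k m i≡ refl u)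
        (end<⁻¹ (x + + ℓ) (+ toℕ y) k m (end-eq x k (+ ℓ) i≡) refl v)
        (start<⁻¹ (x + + ℓ) (+ toℕ y + + ℓ′) k m (end-eq x k (+ ℓ) i≡) (end-eq (+ toℕ y) (m + k) (+ ℓ′) refl) w)
    nocross {peripheral y ℓ′ _ _} mem (m , inj₂ (u , v , w)) =
      g {+ toℕ y + (m + k) * + N} (lift⇒A (m + k) mem refl refl)
        (end<⁻¹ x (+ toℕ y) k m i≡ refl u)
        (start<⁻¹ x (+ toℕ y + + ℓ′) k m i≡ (end-eq (+ toℕ y) (m + k) (+ ℓ′) refl) v)
        (end<⁻¹ (x + + ℓ) (+ toℕ y + + ℓ′) k m (end-eq x k (+ ℓ) i≡) (end-eq (+ toℕ y) (m + k) (+ ℓ′) refl) w)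
    nocross {central y} mem (m , u , v) =
      h {+ toℕ y + (m + k) * + N} (∈⇒C (m + k) mem refl)
        (start<⁻¹ x (+ toℕ y) k m i≡ refl u)
        (end<⁻¹ (x + + ℓ) (+ toℕ y) k m (end-eq x k (+ ℓ) i≡) refl v)

  C-maximal : ∀ {c} → (∀ {k l} → A k l → k < c → c < l → ⊥) → C c
  C-maximal {c} f = lose (maximal (central (res c)) nocross) refl
    where
    x = + toℕ (res c)
    k = quo c
    nocross : ∀ {β} → β ∈ arcs → ¬ Cross (central (res c)) β
    nocross {peripheral y ℓ _ _} mem (m , u , v) =
      -- Here `Cross` fixes the peripheral arc and translates the central one by `m`, so the lift
      -- over `c` is the translate by `k - m`.
      f {+ toℕ y + (k - m) * + N} (lift⇒A (k - m) mem refl refl)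
        (lem₁ (+ toℕ y) x k m (+ N) (res+quo c) u) (lem₂ (+ toℕ y) x k m (+ N) (+ ℓ) (res+quo c) v)
      where
      lem₁ : ∀ {c} y x k m N → c ≡ x + k * N → y < x + m * N → y + (k - m) * N < c
      lem₁ y x k m N refl p = <-by (gap< p) (solve (y ∷ x ∷ k ∷ m ∷ N ∷ []))
      lem₂ : ∀ {c} y x k m N ℓ → c ≡ x + k * N → x + m * N < y + ℓ → c < y + (k - m) * N + ℓ
      lem₂ y x k m N ℓ refl p = <-by (gap< p) (solve (y ∷ x ∷ k ∷ m ∷ N ∷ ℓ ∷ []))

  periodic : PeriodicTriangulation N
  periodic = record
    { A = A ; C = C
    ; A? = λ i j → any? (lifts? i j) arcs
    ; C? = λ c → any? (centralAt? c) arcs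
    ; A-long = A-long ; A-short = A-short ; A-shift = A-shift ; A-unshift = A-unshift
    ; C-shift = C-shift ; C-unshift = C-unshift ; A∦A = A∦A ; A∦C = A∦C
    ; A-maximal = A-maximal ; C-maximal = C-maximal
    }

  ∑-+ : ∀ n (f g : ℕ → ℕ) → ∑ n (λ ℓ → f ℓ ℕ.+ g ℓ) ≡ ∑ n f ℕ.+ ∑ n g
  ∑-+ zero    f g = refl
  ∑-+ (suc n) f g rewrite ∑-+ n f g = interchange (f n) (g n) (∑ n f) (∑ n g)
    where
    interchange : ∀ a b c d → a ℕ.+ b ℕ.+ (c ℕ.+ d) ≡ a ℕ.+ c ℕ.+ (b ℕ.+ d)
    interchange = ℕRing.solve-∀

  ∑-zero : ∀ n {f : ℕ → ℕ} → (∀ ℓ → ℓ ℕ.< n → f ℓ ≡ 0) → ∑ n f ≡ 0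
  ∑-zero zero    h = refl
  ∑-zero (suc n) h = cong₂ ℕ._+_ (h n ℕ.≤-refl) (∑-zero n λ ℓ p → h ℓ (ℕ.m≤n⇒m≤1+n p))

  ∑-single : ∀ n {f : ℕ → ℕ} m → m ℕ.< n → (∀ ℓ → ℓ ≢ m → f ℓ ≡ 0) → ∑ n f ≡ f m
  ∑-single (suc n) {f} m p h with n ℕ.≟ m
  ... | yes refl = trans (cong (f n ℕ.+_) (∑-zero n λ ℓ q → h ℓ (ℕ.<⇒≢ q))) (ℕ.+-identityʳ (f n))
  ... | no  n≢m  = cong₂ ℕ._+_ (h n n≢m) (∑-single n m (ℕ.≤∧≢⇒< (ℕ.≤-pred p) (n≢m ∘ sym)) h)

  -- At most one element satisfies `P` and `x` does not recur in `xs`, so the two indicators on the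
  -- right are never both 1.
  ind-any-∷ : ∀ {X : Set} {P : X → Set} (P? : Decidable P) {x xs} →
              (∀ {y} → P x → P y → x ≡ y) → All (x ≢_) xs →
              ind (any? P? (x ∷ xs)) ≡ ind (P? x) ℕ.+ ind (any? P? xs)
  ind-any-∷ P? {x} {xs} uniq x∉xs with P? x | any? P? xs
  ... | no _  | no _  = refl
  ... | no _  | yes _ = refl
  ... | yes _ | no _  = refl
  ... | yes p | yes q with find q
  ...   | y , y∈xs , py = contradiction (uniq p py) (All.lookup x∉xs y∈xs)

  length-filter-∷ : ∀ {X : Set} {P : X → Set} (P? : Decidable P) x xs →
                    length (filter P? (x ∷ xs)) ≡ ind (P? x) ℕ.+ length (filter P? xs)
  length-filter-∷ P? x xs with P? x
  ... | yes _ = refl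
  ... | no _  = refl

  offset-injective : ∀ i {m n} → i + + m ≡ i + + n → m ≡ n
  offset-injective i eq = ℕ.≤-antisym (offset-≤ i (≤-reflexive eq)) (offset-≤ i (≤-reflexive (sym eq)))

  lifts-unique : ∀ i j {α β} → Lifts i j α → Lifts i j β → α ≡ β
  lifts-unique i j {peripheral x ℓ p q} {peripheral y ℓ′ p′ q′} (refl , e) (refl , e′)
    with refl ← offset-injective i (trans (sym e) e′) = cong₂ (peripheral x ℓ) (ℕ.≤-irrelevant p p′) (ℕ.≤-irrelevant q q′)

  centralAt-unique : ∀ c {α β} → CentralAt c α → CentralAt c β → α ≡ β
  centralAt-unique c {central x} {central y} refl refl = refl

  module _ (i : ℤ) where

    endsOf : List (Arc N) → ℕ
    endsOf αs = length (filter (res i Fin.≟_) (concatMap boundaryEnds αs))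

    right left : ℕ → Arc N → ℕ
    right ℓ α = ind (lifts? i (i + + ℓ) α)
    left  ℓ α = ind (lifts? (i - + ℓ) i α)

    -- A peripheral arc contributes to each sum only through the term of its own length, which is at
    -- most `N`. A loop at `res i` contributes to both sums, having two ends there.
    endsOf-∷ : ∀ α αs → endsOf (α ∷ αs) ≡
      ∑ (suc N) (λ ℓ → right ℓ α) ℕ.+ ∑ (suc N) (λ ℓ → left ℓ α) ℕ.+ ind (centralAt? i α) ℕ.+ endsOf αs
    endsOf-∷ (central y) αs = begin
      endsOf (central y ∷ αs)
        ≡⟨ length-filter-∷ (res i Fin.≟_) y _ ⟩
      ind (res i Fin.≟ y) ℕ.+ endsOf αs
        ≡⟨ cong (ℕ._+ endsOf αs) (ind-cong (res i Fin.≟ y) (y Fin.≟ res i) sym sym) ⟩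
      0 ℕ.+ 0 ℕ.+ ind (y Fin.≟ res i) ℕ.+ endsOf αs
        ≡⟨ cong₂ (λ u v → u ℕ.+ v ℕ.+ ind (y Fin.≟ res i) ℕ.+ endsOf αs)
             (∑-zero (suc N) λ _ _ → refl) (∑-zero (suc N) λ _ _ → refl) ⟨
      _ ∎
      where open ≡-Reasoning
    endsOf-∷ (peripheral y ℓ p q) αs = begin
      endsOf (peripheral y ℓ p q ∷ αs)
        ≡⟨ trans (length-filter-∷ (res i Fin.≟_) y _) (cong (ind (res i Fin.≟ y) ℕ.+_) (length-filter-∷ (res i Fin.≟_) z _)) ⟩
      ind (res i Fin.≟ y) ℕ.+ (ind (res i Fin.≟ z) ℕ.+ endsOf αs)
        ≡⟨ cong₂ (λ u v → u ℕ.+ (v ℕ.+ endsOf αs)) (sym rights) (sym lefts) ⟩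
      r ℕ.+ (l ℕ.+ endsOf αs)
        ≡⟨ regroup r l (endsOf αs) ⟩
      r ℕ.+ l ℕ.+ 0 ℕ.+ endsOf αs ∎
      where
      open ≡-Reasoning
      α = peripheral y ℓ p q
      z = (toℕ y ℕ.+ ℓ) mod N
      r = ∑ (suc N) (λ ℓ′ → right ℓ′ α)
      l = ∑ (suc N) (λ ℓ′ → left ℓ′ α)
      regroup : ∀ r l e → r ℕ.+ (l ℕ.+ e) ≡ r ℕ.+ l ℕ.+ 0 ℕ.+ e
      regroup = ℕRing.solve-∀
      cancel : ∀ i x y → i ≡ i - x + y → x ≡ y
      cancel i x y eq = ≡-by eq (solve (i ∷ x ∷ y ∷ []))
      i≡ : ∀ i x → i ≡ i - x + x
      i≡ = solve-∀
      rights : r ≡ ind (res i Fin.≟ y)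
      rights = trans
        (∑-single (suc N) ℓ (ℕ.s≤s q) λ ℓ′ ne → ind-no (lifts? i (i + + ℓ′) α)
          λ { (_ , eq) → ne (offset-injective i eq) })
        (ind-cong (lifts? i (i + + ℓ) α) (res i Fin.≟ y) (λ { (eq , _) → sym eq }) (λ eq → sym eq , refl))
      lefts : l ≡ ind (res i Fin.≟ z)
      lefts = trans
        (∑-single (suc N) ℓ (ℕ.s≤s q) λ ℓ′ ne → ind-no (lifts? (i - + ℓ′) i α)
          λ { (_ , eq) → ne (+-injective (cancel i (+ ℓ′) (+ ℓ) eq)) })
        (ind-cong (lifts? (i - + ℓ) i α) (res i Fin.≟ z)
          (λ { (eq , _) → Equivalence.from (res-mod i y ℓ) eq })
          (λ eq → Equivalence.to (res-mod i y ℓ) eq , i≡ i (+ ℓ)))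

  -- Every end of an arc at i is the left or the right end of exactly one lift of it.
  regionsAt-res : ∀ i → regionsAt T (res i) ≡ suc (Ends.ends 1≤N periodic i)
  regionsAt-res i = cong suc (go arcs distinct)
    where
    go : ∀ αs → Unique αs → endsOf i αs ≡
      ∑ (suc N) (λ ℓ → ind (any? (lifts? i (i + + ℓ)) αs)) ℕ.+
      ∑ (suc N) (λ ℓ → ind (any? (lifts? (i - + ℓ) i) αs)) ℕ.+
      ind (any? (centralAt? i) αs)
    go [] AllPairs.[] = sym (cong₂ (λ u v → u ℕ.+ v ℕ.+ 0) (∑-zero (suc N) λ _ _ → refl) (∑-zero (suc N) λ _ _ → refl))
    go (α ∷ αs) (α∉αs AllPairs.∷ uniq) = begin
      endsOf i (α ∷ αs)
        ≡⟨ endsOf-∷ i α αs ⟩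
      a ℕ.+ b ℕ.+ c ℕ.+ endsOf i αs
        ≡⟨ cong (a ℕ.+ b ℕ.+ c ℕ.+_) (go αs uniq) ⟩
      a ℕ.+ b ℕ.+ c ℕ.+ (a′ ℕ.+ b′ ℕ.+ c′)
        ≡⟨ interchange a b c a′ b′ c′ ⟩
      (a ℕ.+ a′) ℕ.+ (b ℕ.+ b′) ℕ.+ (c ℕ.+ c′)
        ≡⟨ cong₂ ℕ._+_ (cong₂ ℕ._+_
             (split (λ ℓ → lifts? i (i + + ℓ)) (λ ℓ → lifts-unique i (i + + ℓ)))
             (split (λ ℓ → lifts? (i - + ℓ) i) (λ ℓ → lifts-unique (i - + ℓ) i)))
             (ind-any-∷ (centralAt? i) (centralAt-unique i) α∉αs) ⟨
      _ ∎
      where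
      open ≡-Reasoning
      a = ∑ (suc N) (λ ℓ → right i ℓ α)
      b = ∑ (suc N) (λ ℓ → left i ℓ α)
      c = ind (centralAt? i α)
      a′ = ∑ (suc N) (λ ℓ → ind (any? (lifts? i (i + + ℓ)) αs))
      b′ = ∑ (suc N) (λ ℓ → ind (any? (lifts? (i - + ℓ) i) αs))
      c′ = ind (any? (centralAt? i) αs)
      interchange : ∀ a b c a′ b′ c′ → a ℕ.+ b ℕ.+ c ℕ.+ (a′ ℕ.+ b′ ℕ.+ c′) ≡
                    (a ℕ.+ a′) ℕ.+ (b ℕ.+ b′) ℕ.+ (c ℕ.+ c′)
      interchange = ℕRing.solve-∀
      split : {P : ℕ → Arc N → Set} (P? : ∀ ℓ → Decidable (P ℓ)) → (∀ ℓ {β γ} → P ℓ β → P ℓ γ → β ≡ γ) →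
        ∑ (suc N) (λ ℓ → ind (any? (P? ℓ) (α ∷ αs))) ≡
        ∑ (suc N) (λ ℓ → ind (P? ℓ α)) ℕ.+ ∑ (suc N) (λ ℓ → ind (any? (P? ℓ) αs))
      split P? u = trans (∑-cong (suc N) λ ℓ → ind-any-∷ (P? ℓ) (u ℓ) α∉αs) (∑-+ (suc N) (λ ℓ → ind (P? ℓ α)) (λ ℓ → ind (any? (P? ℓ) αs)))

lastTrue : {P : ℕ → Set} → Decidable P → P 0 → ∀ n → ¬ P n → ∃[ m ] (P m × ¬ P (suc m))
lastTrue P? p₀ zero    ¬p = contradiction p₀ ¬p
lastTrue P? p₀ (suc n) ¬p with P? n
... | yes p  = n , p , ¬p
... | no  ¬p′ = lastTrue P? p₀ n ¬p′

-- Farey polygons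

-- D i j = det (v i) (v j) and p i = det (v i) w for vectors v i (i ∈ ℤ) in the plane, where w is
-- fixed by the monodromy; g is the greatest common divisor of the values of p.
record Polygon (N : ℕ) : Set where
  field
    D         : ℤ → ℤ → ℤ
    p         : ℤ → ℤ
    g         : ℤ
    ptolemy   : ∀ i j k l → D i k * D j l ≡ D i j * D k l + D i l * D j k
    ptolemyₚ  : ∀ i j k → D i k * p j ≡ D i j * p k + D j k * p i
    D-diag    : ∀ i → D i i ≡ 0ℤ
    D-side    : ∀ i → D i (i + 1ℤ) ≡ 1ℤ
    D-pos     : ∀ {i j} → i < j → 0ℤ < D i j
    p-pos     : ∀ i → 0ℤ < p i
    D-shift   : ∀ i j → D (i + + N) (j + + N) ≡ D i j
    p-shift   : ∀ i → p (i + + N) ≡ p i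
    g-pos     : 0ℤ < g
    g≤p       : ∀ i → g ≤ p i
    -- If `D i k = 1`, then `v i` and `v k` form a lattice basis, so a common value `p i = p k`
    -- divides all values of `p`.
    coprime : ∀ {i k} → D i k ≡ 1ℤ → p i ≡ p k → p i ≡ g

-- Reflection turns the search for Farey neighbours to the right into the search to the left.
mirrorPolygon : ∀ {N} → Polygon N → Polygon N
mirrorPolygon {N} P = record
  { D = λ i j → D (- j) (- i)
  ; p = λ i → p (- i)
  ; g = g
  ; ptolemy = λ i j k l → trans (*-comm (D (- k) (- i)) (D (- l) (- j))) (trans (ptolemy (- l) (- k) (- j) (- i))
      (cong₂ _+_ (*-comm (D (- l) (- k)) (D (- j) (- i))) refl))
  ; ptolemyₚ = λ i j k → trans (ptolemyₚ (- k) (- j) (- i)) (+-comm (D (- k) (- j) * p (- i)) (D (- j) (- i) * p (- k)))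
  ; D-diag = λ i → D-diag (- i)
  ; D-side = λ i → trans (cong (D (- (i + 1ℤ))) (lem i 1ℤ)) (D-side (- (i + 1ℤ)))
  ; D-pos = λ q → D-pos (neg-mono-< q)
  ; p-pos = λ i → p-pos (- i)
  ; D-shift = λ i j → trans (sym (D-shift (- (j + + N)) (- (i + + N)))) (cong₂ D (sym (lem j (+ N))) (sym (lem i (+ N))))
  ; p-shift = λ i → trans (sym (p-shift (- (i + + N)))) (cong p (sym (lem i (+ N))))
  ; g-pos = g-pos
  ; g≤p = λ i → g≤p (- i)
  ; coprime = λ {i} {k} e q → trans q (coprime e (sym q))
  }
  where
  open Polygon P
  lem : ∀ i d → - i ≡ - (i + d) + d
  lem = solve-∀

module Farey {N : ℕ} (1≤N : 1 ℕ.≤ N) (P : Polygon N) where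
  open Polygon P

  -- By Ptolemy's relation and `p (j + N) = p j`, the increase multiplied by `p j` is the positive
  -- number `D j (j + N) * p i`.
  D-grows : ∀ {i j} → i < j → D i j < D i (j + + N)
  D-grows {i} {j} i<j = ≰⇒> (lem (D i j) (D i (j + + N)) (D j (j + + N)) (p i) (p j)
    (trans (ptolemyₚ i j (j + + N)) (cong (λ z → D i j * z + D j (j + + N) * p i) (p-shift j)))
    (D-pos (lem′ j (+ N) (+<+ 1≤N))) (p-pos i) (p-pos j))
    where
    lem′ : ∀ j N → 0ℤ < N → j < j + N
    lem′ j N q = <-by (gap< q) (solve (j ∷ N ∷ []))
    lem : ∀ a b c x y → b * y ≡ a * y + c * x → 0ℤ < c → 0ℤ < x → 0ℤ < y → ¬ b ≤ a
    lem a b c x y eq c>0 x>0 y>0 b≤a = ⊥-by (gap b≤a ⊗ <⇒≤ y>0 ⊕ gap≡ (sym eq) ⊕ gap< c>0 ⊗ <⇒≤ x>0 ⊕ gap< x>0) (solve (a ∷ b ∷ c ∷ x ∷ y ∷ []))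

  -- Each further period raises the integer `D i` by at least one and leaves `p` unchanged.
  far : ∀ {i k} → i < k → ∀ n → ∃[ m ] (+ n < D i (k + + m) × p (k + + m) ≡ p k)
  far {i} {k} i<k zero = 0 , subst (λ z → 0ℤ < D i z) (sym (+-identityʳ k)) (D-pos i<k) ,
                         cong p (+-identityʳ k)
  far {i} {k} i<k (suc n) with far i<k n
  ... | m , q , e = m ℕ.+ N , subst (λ z → + suc n < D i z) (assoc)
            (≤-<-trans (i<j⇒suc[i]≤j q) (D-grows (<-≤-trans i<k (i≤i+j k (+ m))))) ,
          trans (cong p (sym assoc)) (trans (p-shift (k + + m)) e)
    where
    assoc : k + + m + + N ≡ k + + (m ℕ.+ N)
    assoc = +-assoc k (+ m) (+ N)

  -- The vertex v l is v k - v i: by Ptolemy's relation, a side v j v (j+1) of the polygon passing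
  -- over this vector would satisfy D j (j+1) ≥ 2.
  next : ∀ {i k} → i < k → D i k ≡ 1ℤ → p i < p k →
         ∃[ l ] (k < l × D i l ≡ 1ℤ × D k l ≡ 1ℤ × p k ≡ p l + p i)
  next {i} {k} i<k Dik p<p with far i<k ∣ p k ∣
  -- Compare `D k z` with `D i z` for `z = k, k + 1, …`. At `z = k` they are 0 and 1; the vertex
  -- sought is the first one found where `D k z` has caught up.
  ... | n , big , pn with lastTrue (λ m → D k (k + + m) <? D i (k + + m)) start n ¬end
    where
    start : D k (k + + 0) < D i (k + + 0)
    start = subst (λ z → D k z < D i z) (sym (+-identityʳ k))
              (subst₂ _<_ (sym (D-diag k)) (sym Dik) (+<+ (ℕ.s≤s ℕ.z≤n)))
    -- At this far point `z`, `D i z` exceeds `p z = p k`. If also `D k z < D i z`, then `p i < p k`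
    -- would make `D i z * p k` larger than `p z + D k z * p i`, to which it is equal.
    ¬end : ¬ D k (k + + n) < D i (k + + n)
    ¬end b<a = lem (D i (k + + n)) (D k (k + + n)) (p i) (p k) (p (k + + n))
      (trans (ptolemyₚ i k (k + + n)) (cong (λ z → z * p (k + + n) + D k (k + + n) * p i) Dik))
      p<p (subst (_< D i (k + + n)) (trans (0≤i⇒+∣i∣≡i (<⇒≤ (p-pos k))) (sym pn)) big)
      b<a (D-pos (<-≤-trans i<k (i≤i+j k (+ n)))) (p-pos i)
      where
      lem : ∀ a b x y z → a * y ≡ 1ℤ * z + b * x → x < y → z < a → b < a → 0ℤ < a → 0ℤ < x → ⊥
      lem a b x y z eq x<y z<a b<a a>0 x>0 = ⊥-by
        (<⇒≤ a>0 ⊗ gap< x<y ⊕ gap< b<a ⊗ <⇒≤ x>0 ⊕ gap≡ eq ⊕ gap< z<a ⊕ gap< x>0 ⊕ 0≤+ 1)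
        (solve (a ∷ b ∷ x ∷ y ∷ z ∷ []))
  ... | m , b<a , b′≮a′ = l , k<l , a′≡1 , trans (sym a′≡b′) a′≡1 ,
    tri (p k) (p l) (p i) (D i l) (D k l) a′≡1 (trans (sym a′≡b′) a′≡1)
      (trans (ptolemyₚ i k l) (cong (λ z → z * p l + D k l * p i) Dik))
    where
    j = k + + m
    l = k + + suc m
    k<l : k < l
    k<l = lem k (+ m) (0≤+ m)
      where
      lem : ∀ k m → 0ℤ ≤ m → k < k + (1ℤ + m)
      lem k m q = <-by q (solve (k ∷ m ∷ []))
    side : D j l ≡ 1ℤ
    side = trans (cong (D j) (lem k (+ m))) (D-side j)
      where
      lem : ∀ k m → k + (1ℤ + m) ≡ k + m + 1ℤ
      lem = solve-∀
    jump : D i j * D k l ≡ 1ℤ + D i l * D k j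
    jump = trans (ptolemy i k j l) (cong (_+ D i l * D k j) (cong₂ _*_ Dik side))
    a>0 : 0ℤ < D i j
    a>0 = D-pos (<-≤-trans i<k (i≤i+j k (+ m)))
    a′>0 : 0ℤ < D i l
    a′>0 = D-pos (<-trans i<k k<l)
    a′≡b′ : D i l ≡ D k l
    a′≡b′ = ≤-antisym (≮⇒≥ b′≮a′) (≮⇒≥ (lem (D i j) (D k j) (D i l) (D k l) jump b<a a>0 a′>0))
      where
      lem : ∀ a b a′ b′ → a * b′ ≡ 1ℤ + a′ * b → b < a → 0ℤ < a → 0ℤ < a′ → ¬ a′ < b′
      lem a b a′ b′ eq b<a a>0 a′>0 a′<b′ = ⊥-by
        (<⇒≤ a>0 ⊗ gap< a′<b′ ⊕ gap< b<a ⊗ <⇒≤ a′>0 ⊕ gap< a>0 ⊕ gap< a′>0 ⊕ gap≡ eq)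
        (solve (a ∷ b ∷ a′ ∷ b′ ∷ []))
    -- With `D i l = D k l`, the relation `jump` reads `D i l * (D i j - D k j) = 1`.
    a′≡1 : D i l ≡ 1ℤ
    a′≡1 = ≤-antisym (lem (D i j) (D k j) (D i l) (D k l) a′≡b′ jump b<a a′>0) (i<j⇒suc[i]≤j a′>0)
      where
      lem : ∀ a b a′ b′ → a′ ≡ b′ → a * b′ ≡ 1ℤ + a′ * b → b < a → 0ℤ < a′ → a′ ≤ 1ℤ
      lem a b a′ .a′ refl eq b<a a′>0 = ≤-by (gap< b<a ⊗ <⇒≤ a′>0 ⊕ gap≡ eq) (solve (a ∷ b ∷ a′ ∷ []))
    tri : ∀ x y z u v → u ≡ 1ℤ → v ≡ 1ℤ → u * x ≡ 1ℤ * y + v * z → x ≡ y + z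
    tri x y z .1ℤ .1ℤ refl refl eq = ≡-by eq (solve (x ∷ y ∷ z ∷ []))

-- Crossings and maximality of the arcs with determinant 1

module Obstructions {N : ℕ} (1≤N : 1 ℕ.≤ N) (P : Polygon N) where
  open Polygon P
  open Farey 1≤N P

  -- This is `next` for the mirrored polygon; here `v l` is `v i - v k`.
  previous : ∀ {i k} → i < k → D i k ≡ 1ℤ → p k < p i →
             ∃[ l ] (l < i × D l i ≡ 1ℤ × D l k ≡ 1ℤ)
  previous {i} {k} i<k Dik q =
    let l , -i<l , Dlk , Dli , _ = Farey.next 1≤N (mirrorPolygon P) (neg-mono-< i<k)
          (trans (cong₂ D (neg-involutive i) (neg-involutive k)) Dik)
          (subst₂ (λ x y → p x < p y) (sym (neg-involutive k)) (sym (neg-involutive i)) q)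
    in - l , -ˡ<⇒-ʳ< -i<l , trans (cong (D (- l)) (sym (neg-involutive i))) Dli ,
       trans (cong (D (- l)) (sym (neg-involutive k))) Dlk

  i<i+1 : ∀ i → i < i + 1ℤ
  i<i+1 i = <-by (0≤+ 0) (solve (i ∷ []))

  -- The value of `p` strictly decreases along the Farey neighbours and serves as fuel for the
  -- descent.
  fuel-step : ∀ {x y z n} → x ≡ y + z → 0ℤ < z → x ≤ + suc n → y ≤ + n
  fuel-step {x} {y} {z} {n} eq q r = lem x y z (+ n) eq q r
    where
    lem : ∀ x y z n → x ≡ y + z → 0ℤ < z → x ≤ 1ℤ + n → y ≤ n
    lem x y z n refl q r = ≤-by (gap< q ⊕ gap r) (solve (y ∷ z ∷ n ∷ []))

  -- Starting from c + 1, p decreases along successive Farey neighbours of c until one of them, y,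
  -- has p y < p c; then v c - v y is a vertex v x with x < c.
  over-central : ∀ {c} → p c ≢ g → ∃[ x ] ∃[ y ] (x < c × c < y × D x y ≡ 1ℤ)
  over-central {c} pc≢g = go ∣ p (c + 1ℤ) ∣ (c + 1ℤ) (i<i+1 c) (D-side c)
    (≤-reflexive (sym (0≤i⇒+∣i∣≡i (<⇒≤ (p-pos (c + 1ℤ))))))
    where
    go : ∀ n k → c < k → D c k ≡ 1ℤ → p k ≤ + n → ∃[ x ] ∃[ y ] (x < c × c < y × D x y ≡ 1ℤ)
    go zero    k c<k Dck q = contradiction (p-pos k) (≤⇒≯ q)
    go (suc n) k c<k Dck q with <-cmp (p c) (p k)
    ... | tri≈ _ eq _ = contradiction (coprime Dck eq) pc≢g
    ... | tri> _ _ pk<pc = let x , x<c , _ , Dxk = previous c<k Dck pk<pc in x , k , x<c , c<k , Dxk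
    ... | tri< pc<pk _ _ = let l , k<l , Dcl , _ , eq = next c<k Dck pc<pk in
      go n l (<-trans c<k k<l) Dcl (fuel-step eq (p-pos c) q)

  data Obstruction (i j : ℤ) : Set where
    rightward : ∀ {x y} → i < x → x < j → j < y → D x y ≡ 1ℤ → Obstruction i j
    leftward  : ∀ {x y} → x < i → i < y → y < j → D x y ≡ 1ℤ → Obstruction i j
    upward    : ∀ {c} → i < c → c < j → p c ≡ g → Obstruction i j

  -- The same descent along Farey neighbours of i, stopped at the latest when it passes over j.
  obstruction : ∀ {i j} → i < j → D i j ≢ 1ℤ → Obstruction i j
  obstruction {i} {j} i<j Dij≢1 = go ∣ p (i + 1ℤ) ∣ (i + 1ℤ) (i<i+1 i) i+1<j (D-side i)
    (≤-reflexive (sym (0≤i⇒+∣i∣≡i (<⇒≤ (p-pos (i + 1ℤ))))))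
    where
    i+1≤j : i + 1ℤ ≤ j
    i+1≤j = ≤-by (gap< i<j) (solve (i ∷ j ∷ []))
    i+1<j : i + 1ℤ < j
    i+1<j = ≤∧≢⇒< i+1≤j
                  (λ eq → Dij≢1 (trans (cong (D i) (sym eq)) (D-side i)))
    further : ∀ n {k l} → i < k → k < j → k < l → D i l ≡ 1ℤ → D k l ≡ 1ℤ → p l ≤ + n →
              Tri (l < j) (l ≡ j) (j < l) → Obstruction i j
    go : ∀ n k → i < k → k < j → D i k ≡ 1ℤ → p k ≤ + n → Obstruction i j
    go zero    k i<k k<j Dik q = contradiction (p-pos k) (≤⇒≯ q)
    go (suc n) k i<k k<j Dik q with <-cmp (p i) (p k)
    -- Equal values make `k` central. If instead `p k < p i`, some arc ends at `k` and passes over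
    -- `i`; if `p i < p k`, the descent goes on to the next neighbour.
    ... | tri≈ _ eq _ = upward i<k k<j (trans (sym eq) (coprime Dik eq))
    ... | tri> _ _ pk<pi = let x , x<i , _ , Dxk = previous i<k Dik pk<pi in leftward x<i i<k k<j Dxk
    ... | tri< pi<pk _ _ =
      let l , k<l , Dil , Dkl , eq = next i<k Dik pi<pk in
      further n i<k k<j k<l Dil Dkl (fuel-step eq (p-pos i) q) (<-cmp l j)

    further n {l = l} i<k k<j k<l Dil Dkl q (tri< l<j _ _) = go n l (<-trans i<k k<l) l<j Dil q
    further n i<k k<j k<l Dil Dkl q (tri≈ _ l≡j _) = contradiction (trans (cong (D i) (sym l≡j)) Dil) Dij≢1
    further n i<k k<j k<l Dil Dkl q (tri> _ _ j<l) = rightward i<k k<j j<l Dkl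

  -- Otherwise `D i (j - N)` would be at least 1, and `D-grows` would make `D i j` at least 2.
  unit-short : ∀ {i j} → i < j → D i j ≡ 1ℤ → j ≤ i + + N
  unit-short {i} {j} i<j Dij = ≮⇒≥ λ i+N<j → <-irrefl refl (≤-<-trans
    (i<j⇒suc[i]≤j (D-pos (lem i j (+ N) i+N<j)))
    (subst (D i (j - + N) <_) (trans (cong (D i) (back j (+ N))) Dij) (D-grows (lem i j (+ N) i+N<j))))
    where
    back : ∀ j N → j - N + N ≡ j
    back = solve-∀
    lem : ∀ i j N → i + N < j → i < j - N
    lem i j N q = <-by (gap< q) (solve (i ∷ j ∷ N ∷ []))

  two-terms : ∀ {a b c d x y} → x ≡ 1ℤ → y ≡ 1ℤ → x * y ≡ a * b + c * d →
              0ℤ < a → 0ℤ < b → 0ℤ < c → 0ℤ < d → ⊥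
  two-terms {a} {b} {c} {d} refl refl eq a>0 b>0 c>0 d>0 = ⊥-by
    (gap< a>0 ⊗ <⇒≤ b>0 ⊕ gap< b>0 ⊕ gap< c>0 ⊗ <⇒≤ d>0 ⊕ gap< d>0 ⊕ gap≡ (sym eq))
    (solve (a ∷ b ∷ c ∷ d ∷ []))

  -- Ptolemy's relation would write `1 * 1` as a sum of two positive integers.
  units-∦ : ∀ {i k j l} → D i j ≡ 1ℤ → D k l ≡ 1ℤ → i < k → k < j → j < l → ⊥
  units-∦ {i} {k} {j} {l} Dij Dkl u v w = two-terms Dij Dkl (ptolemy i k j l)
    (D-pos u) (D-pos w) (D-pos (<-trans u (<-trans v w))) (D-pos v)

  -- Otherwise `p c = D i c * p j + D c j * p i` would be at least `g + g`.
  central-∦ : ∀ {i c j} → D i j ≡ 1ℤ → p c ≡ g → i < c → c < j → ⊥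
  central-∦ {i} {c} {j} Dij pc u v = lem (D i j) (D i c) (D c j) (p c) (p i) (p j) g Dij pc
    (ptolemyₚ i c j) (D-pos u) (D-pos v) (g≤p i) (g≤p j) g-pos
    where
    lem : ∀ a b c x y z h → a ≡ 1ℤ → x ≡ h → a * x ≡ b * z + c * y →
          0ℤ < b → 0ℤ < c → h ≤ y → h ≤ z → 0ℤ < h → ⊥
    lem .1ℤ b c x y z .x refl refl eq b>0 c>0 q r s = ⊥-by
      (gap≡ (sym eq) ⊕ gap< b>0 ⊗ (<⇒≤ s ⊕ gap r) ⊕ gap< c>0 ⊗ (<⇒≤ s ⊕ gap q) ⊕ gap q ⊕ gap r ⊕ gap< s)
      (solve (b ∷ c ∷ x ∷ y ∷ z ∷ []))

-- From a polygon to a triangulation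

_≟ᴬ_ : ∀ {N} → DecidableEquality (Arc N)
peripheral x ℓ p q ≟ᴬ peripheral y ℓ′ p′ q′ = map′
  (λ { (refl , refl) → cong₂ (peripheral x ℓ) (ℕ.≤-irrelevant p p′) (ℕ.≤-irrelevant q q′) })
  (λ { refl → refl , refl }) ((x Fin.≟ y) ×-dec (ℓ ℕ.≟ ℓ′))
peripheral _ _ _ _ ≟ᴬ central _          = no λ ()
central _          ≟ᴬ peripheral _ _ _ _ = no λ ()
central x          ≟ᴬ central y          = map′ (cong central) (λ { refl → refl }) (x Fin.≟ y)

peripherals : ∀ {N} → Fin N → ℕ → List (Arc N)
peripherals {N} x ℓ with 2 ℕ.≤? ℓ | ℓ ℕ.≤? N
... | yes p | yes q = peripheral x ℓ p q ∷ []
... | yes _ | no _  = []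
... | no _  | _     = []

allArcs : ∀ N → List (Arc N)
allArcs N = concatMap (λ x → central x ∷ concatMap (peripherals x) (upTo (suc N))) (allFin N)

∈-peripherals : ∀ {N} (x : Fin N) ℓ p q → peripheral x ℓ p q ∈ peripherals x ℓ
∈-peripherals {N} x ℓ p q with 2 ℕ.≤? ℓ | ℓ ℕ.≤? N
... | yes _  | yes _  = here (cong₂ (peripheral x ℓ) (ℕ.≤-irrelevant _ _) (ℕ.≤-irrelevant _ _))
... | yes _  | no ¬q  = contradiction q ¬q
... | no ¬p  | _      = contradiction p ¬p

∈-allArcs : ∀ {N} (α : Arc N) → α ∈ allArcs N
∈-allArcs (central x)          = ∈-concatMap⁺ _ (lose (∈-allFin x) (here refl))
∈-allArcs (peripheral x ℓ p q) = ∈-concatMap⁺ _ (lose (∈-allFin x)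
  (there (∈-concatMap⁺ (peripherals x) (lose (∈-upTo⁺ (ℕ.s≤s q)) (∈-peripherals x ℓ p q)))))

-- Stated for two arguments to serve `D`; `p` enters as a function that ignores the second one.
shifts : ∀ (N : ℕ) {X : Set} (f : ℤ → ℤ → X) → (∀ i j → f (i + + N) (j + + N) ≡ f i j) →
         ∀ i j k → f (i + k * + N) (j + k * + N) ≡ f i j
shifts N f h i j (+ zero)       = cong₂ f (lem i (+ N)) (lem j (+ N))
  where
  lem : ∀ i N → i + 0ℤ * N ≡ i
  lem = solve-∀
shifts N f h i j (+ suc k)      = trans (cong₂ f (lem i (+ k) (+ N)) (lem j (+ k) (+ N)))
  (trans (h (i + + k * + N) (j + + k * + N)) (shifts N f h i j (+ k)))
  where
  lem : ∀ i k N → i + (1ℤ + k) * N ≡ i + k * N + N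
  lem = solve-∀
shifts N f h i j -[1+ zero ]    = trans (sym (h _ _)) (cong₂ f (lem i (+ N)) (lem j (+ N)))
  where
  lem : ∀ i N → i + -1ℤ * N + N ≡ i
  lem = solve-∀
shifts N f h i j -[1+ (suc k) ] = trans (sym (h _ _)) (trans
  (cong₂ f (lem i -[1+ suc k ] -[1+ k ] (+ N) refl) (lem j -[1+ suc k ] -[1+ k ] (+ N) refl)) (shifts N f h i j -[1+ k ]))
  where
  lem : ∀ i l k N → 1ℤ + l ≡ k → i + l * N + N ≡ i + k * N
  lem i l .(1ℤ + l) N refl = solve (i ∷ l ∷ N ∷ [])

-- The arcs of the triangulation are those with D = 1, and those to the puncture with p = g.
module ToTriangulation {N : ℕ} {{nz : ℕ.NonZero N}} (P : Polygon N) where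
  open Polygon P
  open Residue N
  1≤N = ℕ.>-nonZero⁻¹ N
  open Obstructions 1≤N P

  IsUnit : Arc N → Set
  IsUnit (peripheral x ℓ _ _) = D (+ toℕ x) (+ toℕ x + + ℓ) ≡ 1ℤ
  IsUnit (central x)          = p (+ toℕ x) ≡ g

  isUnit? : Decidable IsUnit
  isUnit? (peripheral x ℓ _ _) = D (+ toℕ x) (+ toℕ x + + ℓ) ≟ 1ℤ
  isUnit? (central x)          = p (+ toℕ x) ≟ g

  -- Removing repetitions gives `distinct` without a separate proof that `allArcs` has none.
  unitArcs : List (Arc N)
  unitArcs = deduplicate _≟ᴬ_ (filter isUnit? (allArcs N))

  ∈⇒unit : ∀ {α} → α ∈ unitArcs → IsUnit α
  ∈⇒unit mem = proj₂ (∈-filter⁻ isUnit? {xs = allArcs N} (∈-deduplicate⁻ _≟ᴬ_ _ mem))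

  unit⇒∈ : ∀ {α} → IsUnit α → α ∈ unitArcs
  unit⇒∈ {α} u = ∈-deduplicate⁺ _≟ᴬ_ (∈-filter⁺ isUnit? (∈-allArcs α) u)

  D-shifts : ∀ i j k → D (i + k * + N) (j + k * + N) ≡ D i j
  D-shifts = shifts N D D-shift

  p-shifts : ∀ i k → p (i + k * + N) ≡ p i
  p-shifts i = shifts N (λ i _ → p i) (λ i _ → p-shift i) i i

  unit-noncrossing : ∀ {α β} → IsUnit α → IsUnit β → ¬ Cross α β
  unit-noncrossing {peripheral x ℓ _ _} {peripheral y ℓ′ _ _} u v (k , inj₁ (q , r , s)) =
    units-∦ u (trans (D-shifts (+ toℕ y) (+ toℕ y + + ℓ′) k) v) q r s
  unit-noncrossing {peripheral x ℓ _ _} {peripheral y ℓ′ _ _} u v (k , inj₂ (q , r , s)) =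
    units-∦ (trans (D-shifts (+ toℕ y) (+ toℕ y + + ℓ′) k) v) u q r s
  unit-noncrossing {peripheral x ℓ _ _} {central y} u v (k , q , r) =
    central-∦ u (trans (p-shifts (+ toℕ y) k) v) q r
  unit-noncrossing {central x} {peripheral y ℓ _ _} u v (k , q , r) =
    central-∦ v (trans (p-shifts (+ toℕ x) k) u) q r

  record Covering (i j : ℤ) : Set where
    field
      {ℓ}  : ℕ
      2≤ℓ  : 2 ℕ.≤ ℓ
      ℓ≤N  : ℓ ℕ.≤ N
      mem  : peripheral (res i) ℓ 2≤ℓ ℓ≤N ∈ unitArcs
      end  : j ≡ + toℕ (res i) + + ℓ + quo i * + N

  -- The point `c` strictly inside rules out a boundary segment, and `unit-short` bounds the length
  -- by one turn.
  covering : ∀ {i c j} → i < c → c < j → D i j ≡ 1ℤ → Covering i j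
  covering {i} {c} {j} i<c c<j Dij with offset (<⇒≤ (<-trans i<c c<j))
  ... | ℓ , refl = record
    { 2≤ℓ = offset-≤ i i+2≤j
    ; ℓ≤N = offset-≤ i (unit-short (<-trans i<c c<j) Dij)
    ; mem = unit⇒∈ (trans (sym (D-shifts (+ toℕ (res i)) (+ toℕ (res i) + + ℓ) (quo i)))
                          (trans (cong₂ D (sym (res+quo i)) (sym end)) Dij))
    ; end = end
    }
    where
    i+2≤j : i + + 2 ≤ i + + ℓ
    i+2≤j = lem i c (i + + ℓ) i<c c<j
      where
      lem : ∀ i c j → i < c → c < j → i + + 2 ≤ j
      lem i c j p q = ≤-by (gap< p ⊕ gap< q) (solve (i ∷ c ∷ j ∷ []))
    end : i + + ℓ ≡ + toℕ (res i) + + ℓ + quo i * + N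
    end = trans (cong (_+ + ℓ) (res+quo i)) (lem (+ toℕ (res i)) (quo i) (+ ℓ) (+ N))
      where
      lem : ∀ x k ℓ N → x + k * N + ℓ ≡ x + ℓ + k * N
      lem = solve-∀

  unit-maximal : ∀ α → (∀ {β} → β ∈ unitArcs → ¬ Cross α β) → IsUnit α
  unit-maximal (central x) h = decidable-stable (p (+ toℕ x) ≟ g) λ ≢g →
    let i , j , i<c , c<j , Dij = over-central ≢g
        open Covering (covering i<c c<j Dij)
    -- Bringing the arc from `i` back to its representative moves the central point by `- quo i`
    -- periods as well.
    in h mem (- quo i , lem₁ i (+ toℕ x) (+ toℕ (res i)) (quo i) (+ N) (res+quo i) i<c ,
                        lem₂ j (+ toℕ x) (+ toℕ (res i) + + ℓ) (quo i) (+ N) end c<j)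
    where
    lem₁ : ∀ i x y k N → i ≡ y + k * N → i < x → y < x + - k * N
    lem₁ i x y k N refl q = <-by (gap< q) (solve (x ∷ y ∷ k ∷ N ∷ []))
    lem₂ : ∀ j x y k N → j ≡ y + k * N → x < j → x + - k * N < y
    lem₂ j x y k N refl q = <-by (gap< q) (solve (x ∷ y ∷ k ∷ N ∷ []))
  unit-maximal (peripheral x ℓ 2≤ℓ ℓ≤N) h =
    decidable-stable (D (+ toℕ x) (+ toℕ x + + ℓ) ≟ 1ℤ) λ ≢1 → crossed (obstruction start<end ≢1)
    where
    start<end : + toℕ x < + toℕ x + + ℓ
    start<end = lem (+ toℕ x) (+ ℓ) (+≤+ 2≤ℓ)
      where
      lem : ∀ x ℓ → + 2 ≤ ℓ → x < x + ℓ
      lem x ℓ q = <-by (gap q ⊕ 0≤+ 1) (solve (x ∷ ℓ ∷ []))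
    crossed : ¬ Obstruction (+ toℕ x) (+ toℕ x + + ℓ)
    crossed (rightward {i} {j} u v w Dij) = h mem (quo i , inj₁
      (subst (_ <_) (res+quo i) u , subst (_< _) (res+quo i) v , subst (_ <_) end w))
      where open Covering (covering v w Dij)
    crossed (leftward {i} {j} u v w Dij) = h mem (quo i , inj₂
      (subst (_< _) (res+quo i) u , subst (_ <_) end v , subst (_< _) end w))
      where open Covering (covering u v Dij)
    crossed (upward {c} u v pc) = h {central (res c)} (unit⇒∈ (trans (sym (p-shifts (+ toℕ (res c)) (quo c)))
        (trans (cong p (sym (res+quo c))) pc)))
      (quo c , subst (_ <_) (res+quo c) u , subst (_< _) (res+quo c) v)

  triangulation : Triangulation N
  triangulation = record
    { arcs        = unitArcs
    ; distinct    = deduplicate-! _≟ᴬ_ (filter isUnit? (allArcs N))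
    ; noncrossing = λ α∈ β∈ → unit-noncrossing (∈⇒unit α∈) (∈⇒unit β∈)
    ; maximal     = λ α h → unit⇒∈ (unit-maximal α h)
    }

  open FromTriangulation triangulation using (periodic; A⇒lift; C⇒∈; lift; regionsAt-res)
  open PeriodicTriangulation periodic using (A; C)
  open Ends 1≤N periodic using (E; ends; module Values)

  A⇒unit : ∀ {i j} → A i j → D i j ≡ 1ℤ
  A⇒unit {i} a with A⇒lift a
  ... | lift {ℓ} _ _ mem refl = trans (cong₂ D (res+quo i) (trans (cong (_+ + ℓ) (res+quo i)) (lem x k (+ ℓ) (+ N))))
      (trans (D-shifts x (x + + ℓ) k) (∈⇒unit mem))
    where
    x = + toℕ (res i)
    k = quo i
    lem : ∀ x k ℓ N → x + k * N + ℓ ≡ x + ℓ + k * N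
    lem = solve-∀

  E⇒unit : ∀ {i j} → E i j → D i j ≡ 1ℤ
  E⇒unit {i} (inj₁ refl) = D-side i
  E⇒unit (inj₂ a)        = A⇒unit a

  C⇒unit : ∀ {c} → C c → p c ≡ g
  C⇒unit {c} d = trans (cong p (res+quo c)) (trans (p-shifts (+ toℕ (res c)) (quo c)) (∈⇒unit (C⇒∈ d)))

  regions-sum : ∀ i → p (i - 1ℤ) + p (i + 1ℤ) ≡ + regionsAt triangulation (res i) * p i
  regions-sum i = trans (Values.neighbour-sum p g C⇒unit triangle i)
                        (cong (λ n → + n * p i) (sym (regionsAt-res i)))
    where
    triangle : ∀ {l i r} → E l i → E i r → A l r → p i ≡ p l + p r
    triangle {l} {i} {r} e e′ a = lem (p i) (p l) (p r) (D l r) (D l i) (D i r)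
      (A⇒unit a) (E⇒unit e) (E⇒unit e′) (ptolemyₚ l i r)
      where
      lem : ∀ x y z a b c → a ≡ 1ℤ → b ≡ 1ℤ → c ≡ 1ℤ → a * x ≡ b * z + c * y → x ≡ y + z
      lem x y z .1ℤ .1ℤ .1ℤ refl refl refl eq = ≡-by eq (solve (x ∷ y ∷ z ∷ []))

-- The recurrence and its monodromy

ℤ-ind : (P : ℤ → Set) → P 0ℤ → (∀ i → P i → P (i + 1ℤ)) → (∀ i → P (i + 1ℤ) → P i) → ∀ i → P i
ℤ-ind P z up down (+ zero)      = z
ℤ-ind P z up down (+ suc n)     = subst P (cong +_ (ℕ.+-comm n 1)) (up (+ n) (ℤ-ind P z up down (+ n)))
ℤ-ind P z up down -[1+ zero ]   = down -1ℤ z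
ℤ-ind P z up down -[1+ suc n ]  = down -[1+ suc n ] (ℤ-ind P z up down -[1+ n ])

module Recurrence (a : ℤ → ℤ) where

  Solves : (ℤ → ℤ) → Set
  Solves f = ∀ i → f (i - 1ℤ) + f (i + 1ℤ) ≡ a i * f i

  module _ (x y : ℤ) where
    forward : ℕ → ℤ
    forward zero          = x
    forward (suc zero)    = y
    forward (suc (suc n)) = a (+ suc n) * forward (suc n) - forward n

    -- Indexed by distance from 0: `backward n` is the value at `- n`.
    backward : ℕ → ℤ
    backward zero          = x
    backward (suc zero)    = a 0ℤ * x - y
    backward (suc (suc n)) = a -[1+ n ] * backward (suc n) - backward n

    solution : ℤ → ℤ
    solution (+ n)    = forward n
    solution -[1+ n ] = backward (suc n)

    private
      cancelʳ : ∀ u v → v + (u - v) ≡ u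
      cancelʳ = solve-∀
      cancelˡ : ∀ u v → u - v + v ≡ u
      cancelˡ = solve-∀

    solution-solves : Solves solution
    solution-solves (+ zero)     = cancelˡ (a 0ℤ * x) y
    solution-solves (+ suc n)    = trans (cong (λ k → forward n + forward (suc k)) (ℕ.+-comm n 1))
      (cancelʳ (a (+ suc n) * forward (suc n)) (forward n))
    solution-solves -[1+ zero ]  = cancelˡ (a -1ℤ * backward 1) x
    solution-solves -[1+ suc n ] = trans
      (cong (λ k → backward (suc (suc (suc k))) + backward (suc n)) (ℕ.+-identityʳ n))
      (cancelˡ (a -[1+ suc n ] * backward (suc (suc n))) (backward (suc n)))

  solves-next : ∀ {f} → Solves f → ∀ i → f (i + 1ℤ + 1ℤ) ≡ a (i + 1ℤ) * f (i + 1ℤ) - f i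
  solves-next {f} s i = lem (f i) (f (i + 1ℤ + 1ℤ)) (a (i + 1ℤ) * f (i + 1ℤ))
    (trans (cong (λ j → f j + f (i + 1ℤ + 1ℤ)) (sym (i≡ i))) (s (i + 1ℤ)))
    where
    i≡ : ∀ i → i + 1ℤ - 1ℤ ≡ i
    i≡ = solve-∀
    lem : ∀ x y z → x + y ≡ z → y ≡ z - x
    lem x y z eq = ≡-by eq (solve (x ∷ y ∷ z ∷ []))

  solves-unique : ∀ {f h} → Solves f → Solves h → f 0ℤ ≡ h 0ℤ → f 1ℤ ≡ h 1ℤ → ∀ i → f i ≡ h i
  solves-unique {f} {h} s t e₀ e₁ i = proj₁ (ℤ-ind (λ i → f i ≡ h i × f (i + 1ℤ) ≡ h (i + 1ℤ)) (e₀ , e₁)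
    (λ i (e , e′) → e′ , trans (solves-next s i) (trans (cong₂ (λ u v → a (i + 1ℤ) * u - v) e′ e) (sym (solves-next t i))))
    (λ i (e , e′) → back {i} e e′ , e) i)
    where
    back : ∀ {i} → f (i + 1ℤ) ≡ h (i + 1ℤ) → f (i + 1ℤ + 1ℤ) ≡ h (i + 1ℤ + 1ℤ) → f i ≡ h i
    back {i} e e′ = lem (f i) (h i) (a (i + 1ℤ) * f (i + 1ℤ)) (trans (sym (solves-next s i)) (trans e′
      (trans (solves-next t i) (cong (λ u → a (i + 1ℤ) * u - h i) (sym e)))))
      where
      lem : ∀ x y z → z - x ≡ z - y → x ≡ y
      lem x y z eq = ≡-by (sym eq) (solve (x ∷ y ∷ z ∷ []))

  -- The coordinates of `v i`. Every solution is a combination of them, with its values at 0 and 1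
  -- as coefficients.
  X Y : ℤ → ℤ
  X = solution 1ℤ 0ℤ
  Y = solution 0ℤ 1ℤ

  X-solves : Solves X
  X-solves = solution-solves 1ℤ 0ℤ

  Y-solves : Solves Y
  Y-solves = solution-solves 0ℤ 1ℤ

  D : ℤ → ℤ → ℤ
  D i j = X i * Y j - Y i * X j

  combination-solves : ∀ u v → Solves (λ i → u * X i + v * Y i)
  combination-solves u v i = lem u v (X (i - 1ℤ)) (X i) (X (i + 1ℤ)) (Y (i - 1ℤ)) (Y i) (Y (i + 1ℤ)) (a i)
    (X-solves i) (Y-solves i)
    where
    lem : ∀ u v x y z x′ y′ z′ c → x + z ≡ c * y → x′ + z′ ≡ c * y′ →
          u * x + v * x′ + (u * z + v * z′) ≡ c * (u * y + v * y′)
    lem u v x y z x′ y′ z′ c eq eq′ = ≡-by (cong₂ _+_ (cong (u *_) eq) (cong (v *_) eq′))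
      (solve (u ∷ v ∷ x ∷ y ∷ z ∷ x′ ∷ y′ ∷ z′ ∷ c ∷ []))

  decompose : ∀ {f} → Solves f → ∀ i → f i ≡ f 0ℤ * X i + f 1ℤ * Y i
  decompose {f} s = solves-unique s (combination-solves (f 0ℤ) (f 1ℤ)) (lem₀ (f 0ℤ) (f 1ℤ)) (lem₁ (f 0ℤ) (f 1ℤ))
    where
    lem₀ : ∀ u v → u ≡ u * 1ℤ + v * 0ℤ
    lem₀ = solve-∀
    lem₁ : ∀ u v → v ≡ u * 0ℤ + v * 1ℤ
    lem₁ = solve-∀

  D-diag : ∀ i → D i i ≡ 0ℤ
  D-diag i = lem (X i) (Y i)
    where
    lem : ∀ x y → x * y - y * x ≡ 0ℤ
    lem = solve-∀

  ptolemy : ∀ i j k l → D i k * D j l ≡ D i j * D k l + D i l * D j k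
  ptolemy i j k l = lem (X i) (X j) (X k) (X l) (Y i) (Y j) (Y k) (Y l)
    where
    lem : ∀ a b c d e f g h → (a * g - e * c) * (b * h - f * d) ≡
          (a * f - e * b) * (c * h - g * d) + (a * h - e * d) * (b * g - f * c)
    lem = solve-∀

  -- A combination of `X` and `Y` is the determinant of `v i` with a fixed vector, so this is
  -- Ptolemy's relation with that vector in place of `v l`.
  ptolemy-combination : ∀ u v i j k → let p = λ i → u * X i + v * Y i in
                        D i k * p j ≡ D i j * p k + D j k * p i
  ptolemy-combination u v i j k = lem u v (X i) (X j) (X k) (Y i) (Y j) (Y k)
    where
    lem : ∀ u v a b c e f g → (a * g - e * c) * (u * b + v * f) ≡
          (a * f - e * b) * (u * c + v * g) + (b * g - f * c) * (u * a + v * e)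
    lem = solve-∀

  -- Consecutive pairs of vectors are related by a substitution of determinant 1.
  D-next : ∀ i → D (i + 1ℤ) (i + 1ℤ + 1ℤ) ≡ D i (i + 1ℤ)
  D-next i = trans (cong₂ (λ x y → X (i + 1ℤ) * y - Y (i + 1ℤ) * x) (solves-next X-solves i) (solves-next Y-solves i))
    (lem (X i) (X (i + 1ℤ)) (Y i) (Y (i + 1ℤ)) (a (i + 1ℤ)))
    where
    lem : ∀ x x′ y y′ c → x′ * (c * y′ - y) - y′ * (c * x′ - x) ≡ x * y′ - y * x′
    lem = solve-∀

  D-side : ∀ i → D i (i + 1ℤ) ≡ 1ℤ
  D-side = ℤ-ind _ refl (λ i e → trans (D-next i) e) (λ i e → trans (sym (D-next i)) e)

  D-skip : ∀ i → D i (i + 1ℤ + 1ℤ) ≡ a (i + 1ℤ)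
  D-skip i = trans (cong₂ (λ x y → X i * y - Y i * x) (solves-next X-solves i) (solves-next Y-solves i))
    (trans (lem (X i) (X (i + 1ℤ)) (Y i) (Y (i + 1ℤ)) (a (i + 1ℤ)))
           (trans (cong (a (i + 1ℤ) *_) (D-side i)) (*-identityʳ (a (i + 1ℤ)))))
    where
    lem : ∀ x x′ y y′ c → x * (c * y′ - y) - y * (c * x′ - x) ≡ c * (x * y′ - y * x′)
    lem = solve-∀

  module Periodic (N : ℤ) (a-shift : ∀ i → a (i + N) ≡ a i) where

    solves-shift : ∀ {f} → Solves f → Solves (λ i → f (i + N))
    solves-shift {f} s i = trans (cong₂ (λ j k → f j + f k) (lem₁ i N) (lem₂ i N))
      (trans (s (i + N)) (cong (_* f (i + N)) (a-shift i)))
      where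
      lem₁ : ∀ i N → i - 1ℤ + N ≡ i + N - 1ℤ
      lem₁ = solve-∀
      lem₂ : ∀ i N → i + 1ℤ + N ≡ i + N + 1ℤ
      lem₂ = solve-∀

    -- The entries of the monodromy matrix, whose columns are `v N` and `v (N + 1)`; by
    -- `shift-decompose` it maps `v i` to `v (i + N)`.
    Xₙ Yₙ Xₙ₊₁ Yₙ₊₁ trace : ℤ
    Xₙ = X N
    Yₙ = Y N
    Xₙ₊₁ = X (N + 1ℤ)
    Yₙ₊₁ = Y (N + 1ℤ)
    trace = Xₙ + Yₙ₊₁

    det : Xₙ * Yₙ₊₁ - Yₙ * Xₙ₊₁ ≡ 1ℤ
    det = D-side N

    shift-decompose : ∀ {f} → Solves f → ∀ i → f (i + N) ≡ f N * X i + f (N + 1ℤ) * Y i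
    shift-decompose {f} s i = trans (decompose (solves-shift s) i)
      (cong₂ (λ u v → f u * X i + f v * Y i) (+-identityˡ N) (+-comm 1ℤ N))

    -- Both vectors are moved by the monodromy matrix, whose determinant is 1.
    D-shift : ∀ i j → D (i + N) (j + N) ≡ D i j
    D-shift i j = trans
      (cong₂ _-_ (cong₂ _*_ (shift-decompose X-solves i) (shift-decompose Y-solves j))
                 (cong₂ _*_ (shift-decompose Y-solves i) (shift-decompose X-solves j)))
      (trans (lem Xₙ Xₙ₊₁ Yₙ Yₙ₊₁ (X i) (X j) (Y i) (Y j))
             (trans (cong (_* D i j) det) (*-identityˡ (D i j))))
      where
      lem : ∀ p q r s a b c d →
            (p * a + q * c) * (r * b + s * d) - (r * a + s * c) * (p * b + q * d) ≡
            (p * s - r * q) * (a * d - c * b)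
      lem = solve-∀

    X-CayleyHamilton : ∀ i → X (i + N + N) ≡ trace * X (i + N) - X i
    X-CayleyHamilton i = begin
      X (i + N + N)
        ≡⟨ shift-decompose X-solves (i + N) ⟩
      Xₙ * X (i + N) + Xₙ₊₁ * Y (i + N)
        ≡⟨ cong₂ (λ u v → Xₙ * u + Xₙ₊₁ * v) (shift-decompose X-solves i) (shift-decompose Y-solves i) ⟩
      Xₙ * x′ + Xₙ₊₁ * (Yₙ * X i + Yₙ₊₁ * Y i)
        ≡⟨ lem Xₙ Xₙ₊₁ Yₙ Yₙ₊₁ (X i) (Y i) ⟩
      trace * x′ - (Xₙ * Yₙ₊₁ - Yₙ * Xₙ₊₁) * X i
        ≡⟨ cong₂ (λ u v → trace * u - v * X i) (sym (shift-decompose X-solves i)) det ⟩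
      trace * X (i + N) - 1ℤ * X i
        ≡⟨ cong (λ z → trace * X (i + N) - z) (*-identityˡ (X i)) ⟩
      trace * X (i + N) - X i ∎
      where
      open ≡-Reasoning
      x′ = Xₙ * X i + Xₙ₊₁ * Y i
      lem : ∀ p q r s a c → p * (p * a + q * c) + q * (r * a + s * c) ≡
            (p + s) * (p * a + q * c) - (p * s - r * q) * a
      lem = solve-∀

    Y-CayleyHamilton : ∀ i → Y (i + N + N) ≡ trace * Y (i + N) - Y i
    Y-CayleyHamilton i = begin
      Y (i + N + N)
        ≡⟨ shift-decompose Y-solves (i + N) ⟩
      Yₙ * X (i + N) + Yₙ₊₁ * Y (i + N)
        ≡⟨ cong₂ (λ u v → Yₙ * u + Yₙ₊₁ * v) (shift-decompose X-solves i) (shift-decompose Y-solves i) ⟩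
      Yₙ * (Xₙ * X i + Xₙ₊₁ * Y i) + Yₙ₊₁ * y′
        ≡⟨ lem Xₙ Xₙ₊₁ Yₙ Yₙ₊₁ (X i) (Y i) ⟩
      trace * y′ - (Xₙ * Yₙ₊₁ - Yₙ * Xₙ₊₁) * Y i
        ≡⟨ cong₂ (λ u v → trace * u - v * Y i) (sym (shift-decompose Y-solves i)) det ⟩
      trace * Y (i + N) - 1ℤ * Y i
        ≡⟨ cong (λ z → trace * Y (i + N) - z) (*-identityˡ (Y i)) ⟩
      trace * Y (i + N) - Y i ∎
      where
      open ≡-Reasoning
      y′ = Yₙ * X i + Yₙ₊₁ * Y i
      lem : ∀ p q r s a c → r * (p * a + q * c) + s * (r * a + s * c) ≡
            (p + s) * (r * a + s * c) - (p * s - r * q) * c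
      lem = solve-∀

-- Friezes

module FriezeVectors (F : InfiniteFrieze) where
  open InfiniteFrieze F
  open Recurrence (quiddity F) public

  plücker : ∀ i j → D i j * D (i + 1ℤ) (j + 1ℤ) - D i (j + 1ℤ) * D (i + 1ℤ) j ≡ 1ℤ
  plücker i j = trans (lem (X i) (X (i + 1ℤ)) (X j) (X (j + 1ℤ)) (Y i) (Y (i + 1ℤ)) (Y j) (Y (j + 1ℤ)))
                      (cong₂ _*_ (D-side i) (D-side j))
    where
    lem : ∀ a b c d e f g h → (a * g - e * c) * (b * h - f * d) - (a * h - e * d) * (b * g - f * c) ≡
          (a * f - e * b) * (c * h - g * d)
    lem = solve-∀

  -- Induction on the distance `ℓ`: the diamond rule, which `D` obeys by `plücker`, determines each
  -- entry from those at shorter distance. Distance 2 is a base case because the divisor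
  -- `m (I + 1) K` would be 0 there. The indices are given by equations so that the induction
  -- hypotheses fit.
  m≡D : ∀ ℓ {I J i j} → I ≡ i + 1ℤ → J + 1ℤ ≡ j → j ≡ i + + ℓ → m I J ≡ D i j
  m≡D zero {I} {J} {i} {j} refl eq refl = trans (trans (cong (m I) (lem i J eq)) (zeros I))
    (sym (trans (cong (D i) (+-identityʳ i)) (D-diag i)))
    where
    lem : ∀ i J → J + 1ℤ ≡ i + 0ℤ → J ≡ i + 1ℤ - + 2
    lem i J eq = ≡-by eq (solve (i ∷ J ∷ []))
  m≡D (suc zero) {I} {J} {i} refl eq refl = trans (trans (cong (m I) (lem i J eq)) (ones I)) (sym (D-side i))
    where
    lem : ∀ i J → J + 1ℤ ≡ i + 1ℤ → J ≡ i + 1ℤ - 1ℤ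
    lem i J eq = ≡-by eq (solve (i ∷ J ∷ []))
  m≡D (suc (suc zero)) {I} {J} {i} refl eq refl = trans (cong (m I) (lem i J eq))
    (sym (trans (cong (D i) (two i)) (D-skip i)))
    where
    lem : ∀ i J → J + 1ℤ ≡ i + + 2 → J ≡ i + 1ℤ
    lem i J eq = ≡-by eq (solve (i ∷ J ∷ []))
    two : ∀ i → i + + 2 ≡ i + 1ℤ + 1ℤ
    two = solve-∀
  m≡D (suc (suc (suc n))) {I} {J} {i} {j} refl refl eq = finish
    (m≡D (suc (suc n)) {I} {K} {i} refl (K+1≡J) (J≡ i J (+ n) eq))
    (m≡D (suc (suc n)) {I + 1ℤ} {J} {i + 1ℤ} refl refl (j≡ i J (+ n) eq))
    (m≡D (suc n) {I + 1ℤ} {K} {i + 1ℤ} refl K+1≡J (J≡′ i J (+ n) eq))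
    where
    K = J - 1ℤ
    K+1≡J : K + 1ℤ ≡ J
    K+1≡J = lem J
      where
      lem : ∀ J → J - 1ℤ + 1ℤ ≡ J
      lem = solve-∀
    J≡ : ∀ i J n → J + 1ℤ ≡ i + (+ 3 + n) → J ≡ i + (+ 2 + n)
    J≡ i J n eq = ≡-by eq (solve (i ∷ J ∷ n ∷ []))
    j≡ : ∀ i J n → J + 1ℤ ≡ i + (+ 3 + n) → J + 1ℤ ≡ i + 1ℤ + (+ 2 + n)
    j≡ i J n eq = ≡-by eq (solve (i ∷ J ∷ n ∷ []))
    J≡′ : ∀ i J n → J + 1ℤ ≡ i + (+ 3 + n) → J ≡ i + 1ℤ + (1ℤ + n)
    J≡′ i J n eq = ≡-by eq (solve (i ∷ J ∷ n ∷ []))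
    I-1≤K : I - 1ℤ ≤ K
    I-1≤K = lem i J (+ n) eq (0≤+ n)
      where
      lem : ∀ i J n → J + 1ℤ ≡ i + (+ 3 + n) → 0ℤ ≤ n → i + 1ℤ - 1ℤ ≤ J - 1ℤ
      lem i J n eq q = ≤-by (q ⊕ gap≡ (sym eq) ⊕ 0≤+ 1) (solve (i ∷ J ∷ n ∷ []))
    I≤K : I + 1ℤ - 1ℤ ≤ K
    I≤K = lem i J (+ n) eq (0≤+ n)
      where
      lem : ∀ i J n → J + 1ℤ ≡ i + (+ 3 + n) → 0ℤ ≤ n → i + 1ℤ + 1ℤ - 1ℤ ≤ J - 1ℤ
      lem i J n eq q = ≤-by (q ⊕ gap≡ (sym eq)) (solve (i ∷ J ∷ n ∷ []))
    dia : m I K * m (I + 1ℤ) J - m I J * m (I + 1ℤ) K ≡ 1ℤ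
    dia = trans (cong (λ z → m I K * m (I + 1ℤ) z - m I z * m (I + 1ℤ) K) (sym K+1≡J)) (diamond I K I-1≤K)
    finish : m I K ≡ D i J → m (I + 1ℤ) J ≡ D (i + 1ℤ) (J + 1ℤ) → m (I + 1ℤ) K ≡ D (i + 1ℤ) J →
             m I J ≡ D i (J + 1ℤ)
    finish e₁ e₂ e₃ = *-cancelʳ-≡ (m I J) (D i (J + 1ℤ)) (m (I + 1ℤ) K) {{>-nonZero (positive (I + 1ℤ) K I≤K)}}
      (lem (m I K) (m (I + 1ℤ) J) (m I J) (m (I + 1ℤ) K) (D i J) (D (i + 1ℤ) (J + 1ℤ)) (D i (J + 1ℤ)) (D (i + 1ℤ) J)
        e₁ e₂ e₃ dia (plücker i J))
      where
      lem : ∀ a b c d a′ b′ c′ d′ → a ≡ a′ → b ≡ b′ → d ≡ d′ → a * b - c * d ≡ 1ℤ → a′ * b′ - c′ * d′ ≡ 1ℤ → c * d ≡ c′ * d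
      lem a b c d .a .b c′ .d refl refl refl eq eq′ = ≡-by (trans eq′ (sym eq)) (solve (a ∷ b ∷ c ∷ d ∷ c′ ∷ []))

  D-pos : ∀ {i j} → i < j → 0ℤ < D i j
  D-pos {i} {j} i<j with offset (<⇒≤ i<j)
  ... | ℓ , eq = subst (0ℤ <_) (m≡D ℓ {i + 1ℤ} {j - 1ℤ} {i} refl (lem j) eq) (positive (i + 1ℤ) (j - 1ℤ) (bound i j i<j))
    where
    lem : ∀ j → j - 1ℤ + 1ℤ ≡ j
    lem = solve-∀
    bound : ∀ i j → i < j → i + 1ℤ - 1ℤ ≤ j - 1ℤ
    bound i j q = ≤-by (gap< q) (solve (i ∷ j ∷ []))

  D₀ : ∀ j → D 0ℤ j ≡ Y j
  D₀ j = lem (X j) (Y j)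
    where
    lem : ∀ x y → 1ℤ * y - 0ℤ * x ≡ y
    lem = solve-∀

  D₁ : ∀ j → D 1ℤ j ≡ - X j
  D₁ j = lem (X j) (Y j)
    where
    lem : ∀ x y → 0ℤ * y - 1ℤ * x ≡ - x
    lem = solve-∀

  -- The trace of the monodromy over k periods of length n.
  S : ℕ → ℕ → ℤ
  S n k = X (+ (k ℕ.* n)) + Y (+ (k ℕ.* n) + 1ℤ)

  -- With `K = k * n`, the two entries are `D 0 (K + 1) = Y (K + 1)` and `D 1 K = - X K`.
  growth≡S : ∀ n → 1 ℕ.≤ n → ∀ k → growth F n k ≡ S n k
  growth≡S n 1≤n zero    = refl
  growth≡S n 1≤n (suc k) = trans (cong₂ _-_
      (trans (m≡D (suc K) {i = 0ℤ} {j = + K + 1ℤ} refl refl (cong +_ (ℕ.+-comm K 1))) (D₀ (+ K + 1ℤ)))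
      (trans (m≡D (K ℕ.∸ 1) {i = 1ℤ} {j = + K} refl (lem (+ K)) (cong +_ (sym (ℕ.m+[n∸m]≡n 1≤K)))) (D₁ (+ K))))
    (swap (X (+ K)) (Y (+ K + 1ℤ)))
    where
    K = suc k ℕ.* n
    1≤K : 1 ℕ.≤ K
    1≤K = ℕ.≤-trans 1≤n (ℕ.m≤m+n n (k ℕ.* n))
    lem : ∀ j → j - 1ℤ + 1ℤ ≡ j
    lem = solve-∀
    swap : ∀ x y → y - - x ≡ x + y
    swap = solve-∀

  module WithPeriod (n : ℕ) (period : IsPeriod F n) where
    1≤n : 1 ℕ.≤ n
    1≤n = proj₁ period

    a-shift : ∀ i → quiddity F (i + + n) ≡ quiddity F i
    a-shift i = proj₂ period i i (i≤j⇒i-k≤j (+ 2) ≤-refl)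

    open Periodic (+ n) a-shift public

    kn+n : ∀ k → + (suc k ℕ.* n) ≡ + (k ℕ.* n) + + n
    kn+n k = cong +_ (ℕ.+-comm n (k ℕ.* n))

    kn+n+n : ∀ k → + (suc (suc k) ℕ.* n) ≡ + (k ℕ.* n) + + n + + n
    kn+n+n k = trans (kn+n (suc k)) (cong (_+ + n) (kn+n k))

    S-recurrence : ∀ k → S n (suc (suc k)) ≡ trace * S n (suc k) - S n k
    S-recurrence k = trans
      (cong₂ _+_ (trans (cong X (kn+n+n k)) (X-CayleyHamilton κ))
                 (trans (cong Y (trans (cong (_+ 1ℤ) (kn+n+n k)) (move₂ κ (+ n)))) (Y-CayleyHamilton (κ + 1ℤ))))
      (trans (cong₂ (λ x y → trace * x - X κ + (trace * y - Y (κ + 1ℤ)))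
               (cong X (sym (kn+n k))) (cong Y (trans (move₁ κ (+ n)) (cong (_+ 1ℤ) (sym (kn+n k))))))
             (collect trace (X κ) (Y (κ + 1ℤ)) (X (+ (suc k ℕ.* n))) (Y (+ (suc k ℕ.* n) + 1ℤ))))
      where
      κ = + (k ℕ.* n)
      move₂ : ∀ i n → i + n + n + 1ℤ ≡ i + 1ℤ + n + n
      move₂ = solve-∀
      move₁ : ∀ i n → i + 1ℤ + n ≡ i + n + 1ℤ
      move₁ = solve-∀
      collect : ∀ t x y x′ y′ → t * x′ - x + (t * y′ - y) ≡ t * (x′ + y′) - (x + y)
      collect = solve-∀

    S₁ : S n 1 ≡ trace
    S₁ = cong (λ z → X (+ z) + Y (+ z + 1ℤ)) (ℕ.+-identityʳ n)

    Y-positive : ∀ k → 0ℤ < Y (+ (suc k ℕ.* n))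
    Y-positive k = subst (0ℤ <_) (D₀ (+ (suc k ℕ.* n))) (D-pos (+<+ (ℕ.≤-trans 1≤n (ℕ.m≤m+n n (k ℕ.* n)))))

    Y-recurrence : ∀ k → Y (+ (suc (suc k) ℕ.* n)) ≡ trace * Y (+ (suc k ℕ.* n)) - Y (+ (k ℕ.* n))
    Y-recurrence k = trans (cong Y (kn+n+n k)) (trans (Y-CayleyHamilton (+ (k ℕ.* n)))
      (cong (λ z → trace * Y z - Y (+ (k ℕ.* n))) (sym (kn+n k))))

    -- A trace t ≤ 1 would make Y vanish or change sign at 2n (t ≤ 0) or at 3n (t = 1).
    2≤trace : + 2 ≤ trace
    2≤trace = lem trace (Y (+ (1 ℕ.* n))) (Y (+ (2 ℕ.* n))) (Y (+ (3 ℕ.* n))) (Y-recurrence 0) (Y-recurrence 1)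
      (Y-positive 0) (Y-positive 1) (Y-positive 2)
      where
      1≤ : ∀ t x y → y ≡ t * x - 0ℤ → 0ℤ < x → 0ℤ < y → ¬ t ≤ 0ℤ
      1≤ t x y eq x>0 y>0 t≤0 = ⊥-by (gap t≤0 ⊗ <⇒≤ x>0 ⊕ gap≡ eq ⊕ gap< y>0) (solve (t ∷ x ∷ y ∷ []))
      ≢1 : ∀ x y z → y ≡ 1ℤ * x - 0ℤ → z ≡ 1ℤ * y - x → ¬ 0ℤ < z
      ≢1 x y z eq eq′ z>0 = ⊥-by (gap≡ eq ⊕ gap≡ eq′ ⊕ gap< z>0) (solve (x ∷ y ∷ z ∷ []))
      lem : ∀ t x y z → y ≡ t * x - 0ℤ → z ≡ t * y - x → 0ℤ < x → 0ℤ < y → 0ℤ < z → + 2 ≤ t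
      lem t x y z eq eq′ x>0 y>0 z>0 = i<j⇒suc[i]≤j
        (≤∧≢⇒< (i<j⇒suc[i]≤j (≰⇒> (1≤ t x y eq x>0 y>0))) λ { refl → ≢1 x y z eq eq′ z>0 })

    S≡2 : trace ≡ + 2 → ∀ k → S n k ≡ + 2
    S≡2 t k = proj₁ (go k)
      where
      go : ∀ k → S n k ≡ + 2 × S n (suc k) ≡ + 2
      go zero    = refl , trans S₁ t
      go (suc k) = let e , e′ = go k in
        e′ , trans (S-recurrence k) (trans (cong₂ (λ u v → u * v - S n k) t e′) (cong (λ u → + 4 - u) e))

    -- As the trace is at least 3, the recurrence turns `2 ≤ S k < S (k + 1)` into
    -- `S (k + 1) < S (k + 2)`: the sequence increases strictly from 2.
    S>2 : + 2 < trace → ∀ k → + 2 < S n (suc k)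
    S>2 t k = ≤-<-trans (proj₁ (go k)) (proj₂ (go k))
      where
      lem : ∀ t x y z → z ≡ t * y - x → + 2 < t → + 2 ≤ x → x < y → y < z
      lem t x y z refl t>2 x≥2 x<y = <-by
        (gap< t>2 ⊗ (gap x≥2 ⊕ gap< x<y ⊕ 0≤+ 3) ⊕ gap< x<y ⊕ gap< x<y ⊕ gap x≥2 ⊕ 0≤+ 3) (solve (t ∷ x ∷ y ∷ []))
      go : ∀ k → + 2 ≤ S n k × S n k < S n (suc k)
      go zero    = ≤-refl , subst (+ 2 <_) (sym S₁) t
      go (suc k) = let q , r = go k in ≤-trans q (<⇒≤ r) ,
        lem trace (S n k) (S n (suc k)) (S n (suc (suc k))) (S-recurrence k) t q r

-- Trace 2 and the punctured disc

module Disc (F : InfiniteFrieze) (n : ℕ) (period : IsPeriod F n) where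
  open FriezeVectors F
  open WithPeriod n period

  -- (f 0 , f 1) is an eigenvector of the transposed monodromy for the eigenvalue 1; as the
  -- determinant is 1, the trace is 2.
  periodic-solution⇒trace≡2 : ∀ {f} → Solves f → 0ℤ < f 0ℤ → 0ℤ < f 1ℤ → ∀ N →
    f N ≡ f 0ℤ → f (N + 1ℤ) ≡ f 1ℤ → X N + Y (N + 1ℤ) ≡ + 2
  periodic-solution⇒trace≡2 {f} s f₀ f₁ N eq eq′ =
    *-cancelʳ-≡ _ _ (f 0ℤ * f 1ℤ) {{i*j≢0 (f 0ℤ) (f 1ℤ) {{>-nonZero f₀}} {{>-nonZero f₁}}}}
      (lem (f 0ℤ) (f 1ℤ) (X N) (X (N + 1ℤ)) (Y N) (Y (N + 1ℤ))
        (trans (sym eq) (decompose s N)) (trans (sym eq′) (decompose s (N + 1ℤ))) (D-side N))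
    where
    lem : ∀ u v x x′ y y′ → u ≡ u * x + v * y → v ≡ u * x′ + v * y′ → x * y′ - y * x′ ≡ 1ℤ →
          (x + y′) * (u * v) ≡ + 2 * (u * v)
    -- Multiplying `u * (1 - x) = v * y` by `v * (1 - y′) = u * x′` and inserting the determinant 1
    -- leaves `u * v * (2 - x - y′) = 0`.
    lem u v x x′ y y′ e e′ d = ≡-by (combined e e′ d) (identity u v x x′ y y′)
      where
      combined : u ≡ u * x + v * y → v ≡ u * x′ + v * y′ → x * y′ - y * x′ ≡ 1ℤ →
            (u * x + v * y) * (v * (1ℤ - y′)) + (v * y) * (u * x′ + v * y′) + (x * y′ - y * x′) * (u * v) ≡
            u * (v * (1ℤ - y′)) + (v * y) * v + 1ℤ * (u * v)
      combined e e′ d = cong₂ _+_ (cong₂ _+_ (cong (_* (v * (1ℤ - y′))) (sym e)) (cong (v * y *_) (sym e′))) (cong (_* (u * v)) d)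
      identity : ∀ u v x x′ y y′ →
        (u * x + v * y) * (v * (1ℤ - y′)) + (v * y) * (u * x′ + v * y′) + (x * y′ - y * x′) * (u * v) -
        (u * (v * (1ℤ - y′)) + (v * y) * v + 1ℤ * (u * v)) ≡ (x + y′) * (u * v) - + 2 * (u * v)
      identity = solve-∀

  arises⇒growth≡2 : ArisesFromPuncturedDisc F → ∃[ k ] (k ℕ.> 0 × growth F n k ≡ + 2)
  -- The growth coefficient at `k = N` is the trace over `N * n` steps, a multiple of the period `N`
  -- of `p`.
  arises⇒growth≡2 (N , nz , T , r , q) = N , 1≤N , trans (growth≡S n 1≤n N)
    (periodic-solution⇒trace≡2 f-solves (p-pos (0ℤ - r)) (p-pos (1ℤ - r)) (+ (N ℕ.* n))
      (f-period 0ℤ refl) (f-period 1ℤ (+-comm (+ (N ℕ.* n)) 1ℤ)))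
    where
    instance _ = nz
    open FromTriangulation T
    open Residue N
    open Ends 1≤N periodic using (ends; positive-periodic-solution)
    p = proj₁ positive-periodic-solution
    p-pos = proj₁ (proj₂ positive-periodic-solution)
    p-shift = proj₁ (proj₂ (proj₂ positive-periodic-solution))
    p-sum = proj₂ (proj₂ (proj₂ positive-periodic-solution))
    f : ℤ → ℤ
    -- The marked point 0 of the disc sits at index `r` of the frieze.
    f i = p (i - r)
    quiddity≡ : ∀ i → quiddity F i ≡ + suc (ends (i - r))
    quiddity≡ i = trans (cong (quiddity F) (split i r _ _ (res+quo (i - r))))
      (trans (q (quo (i - r)) (res (i - r))) (cong +_ (regionsAt-res (i - r))))
      where
      split : ∀ i r x y → i - r ≡ x + y → i ≡ r + x + y
      split i r x y eq = ≡-by eq (solve (i ∷ r ∷ x ∷ y ∷ []))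
    f-solves : Solves f
    f-solves i = trans (cong₂ (λ j k → p j + p k) (lem₁ i r) (lem₂ i r))
      (trans (p-sum (i - r)) (cong (_* f i) (sym (quiddity≡ i))))
      where
      lem₁ : ∀ i r → i - 1ℤ - r ≡ i - r - 1ℤ
      lem₁ = solve-∀
      lem₂ : ∀ i r → i + 1ℤ - r ≡ i - r + 1ℤ
      lem₂ = solve-∀
    p-shifts : ∀ i k → p (i + + (k ℕ.* N)) ≡ p i
    p-shifts i zero    = cong p (+-identityʳ i)
    p-shifts i (suc k) = trans (cong p (lem i (+ N) (+ (k ℕ.* N)))) (trans (p-shift _) (p-shifts i k))
      where
      lem : ∀ i d e → i + (d + e) ≡ i + e + d
      lem = solve-∀
    f-period : ∀ i {j} → j ≡ i + + (N ℕ.* n) → f j ≡ f i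
    f-period i refl = trans (cong p (trans (lem i r (+ (N ℕ.* n))) (cong (λ z → i - r + + z) (ℕ.*-comm N n)))) (p-shifts (i - r) n)
      where
      lem : ∀ i r d → i + d - r ≡ i - r + d
      lem = solve-∀

  module Parabolic (trace≡2 : trace ≡ + 2) where
    instance
      n≢0 : ℕ.NonZero n
      n≢0 = ℕ.>-nonZero 1≤n
    open Residue n

    -- v n - v 0 is fixed by the monodromy, and p i = det (v i , v n - v 0).
    p : ℤ → ℤ
    p i = Yₙ * X i + (1ℤ - Xₙ) * Y i

    p-solves : Solves p
    p-solves = combination-solves Yₙ (1ℤ - Xₙ)

    p-shift : ∀ i → p (i + + n) ≡ p i
    p-shift i = trans (shift-decompose p-solves i) (cong₂ (λ u v → u * X i + v * Y i)
      (lem₁ Xₙ Yₙ) (lem₂ Xₙ Xₙ₊₁ Yₙ Yₙ₊₁ det trace≡2))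
      where
      lem₁ : ∀ x y → y * x + (1ℤ - x) * y ≡ y
      lem₁ = solve-∀
      lem₂ : ∀ x x′ y y′ → x * y′ - y * x′ ≡ 1ℤ → x + y′ ≡ + 2 → y * x′ + (1ℤ - x) * y′ ≡ 1ℤ - x
      lem₂ x x′ y y′ e e′ = ≡-by (cong₂ _-_ e′ e) (solve (x ∷ x′ ∷ y ∷ y′ ∷ []))

    p-D : ∀ i → p i ≡ D i (+ n) + D 0ℤ i
    p-D i = trans (lem (X i) (Y i) Xₙ Yₙ) (cong (λ z → D i (+ n) + z) (sym (D₀ i)))
      where
      lem : ∀ x y x′ y′ → y′ * x + (1ℤ - x′) * y ≡ x * y′ - y * x′ + y
      lem = solve-∀

    -- For `0 ≤ i < n`, `p-D` adds a positive and a nonnegative determinant; periodicity then covers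
    -- the other `i`.
    p-pos-window : ∀ i → i ℕ.< n → 0ℤ < p (+ i)
    p-pos-window i i<n = subst (0ℤ <_) (sym (p-D (+ i))) (+-mono-<-≤ (D-pos (+<+ i<n)) (nonneg i))
      where
      nonneg : ∀ i → 0ℤ ≤ D 0ℤ (+ i)
      nonneg zero    = ≤-refl
      nonneg (suc i) = <⇒≤ (D-pos {0ℤ} {+ suc i} (+<+ (ℕ.s≤s ℕ.z≤n)))

    p-pos : ∀ i → 0ℤ < p i
    p-pos i = subst (λ z → 0ℤ < p z) (sym (res+quo i))
      (subst (0ℤ <_) (sym (shifts n (λ i _ → p i) (λ i _ → p-shift i) (+ toℕ (res i)) 0ℤ (quo i)))
             (p-pos-window (toℕ (res i)) (Fin.toℕ<n (res i))))

    abs-pos : ∀ {i} → 0ℤ < i → ∣ i ∣ ≢ 0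
    abs-pos (+<+ ()) refl

    +abs : ∀ {i} → 0ℤ < i → i ≡ + ∣ i ∣
    +abs q = sym (0≤i⇒+∣i∣≡i (<⇒≤ q))

    abstract
      -- Two values suffice for the common divisor of all, since `p i = p 0 * X i + p 1 * Y i`.
      d : ℕ
      d = gcd ∣ p 0ℤ ∣ ∣ p 1ℤ ∣

      d∣p₀ : d ℕ.∣ ∣ p 0ℤ ∣
      d∣p₀ = gcd[m,n]∣m ∣ p 0ℤ ∣ ∣ p 1ℤ ∣

      d∣p₁ : d ℕ.∣ ∣ p 1ℤ ∣
      d∣p₁ = gcd[m,n]∣n ∣ p 0ℤ ∣ ∣ p 1ℤ ∣

      d-greatest : ∀ {e} → e ℕ.∣ ∣ p 0ℤ ∣ → e ℕ.∣ ∣ p 1ℤ ∣ → e ℕ.∣ d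
      d-greatest = gcd-greatest

      d>0 : 0 ℕ.< d
      d>0 = ℕ.n≢0⇒n>0 (gcd[m,n]≢0 ∣ p 0ℤ ∣ ∣ p 1ℤ ∣ (inj₁ (abs-pos (p-pos 0ℤ))))

    d-pos : 0ℤ < + d
    d-pos = +<+ d>0

    d-quotient : ∀ {i} → 0ℤ < i → (d∣i : d ℕ.∣ ∣ i ∣) → i ≡ + ℕ.quotient d∣i * + d
    d-quotient q d∣i = trans (+abs q) (trans (cong +_ (ℕ._∣_.equality d∣i)) (pos-* (ℕ.quotient d∣i) d))

    cofactor : ℤ → ℤ
    cofactor i = + ℕ.quotient d∣p₀ * X i + + ℕ.quotient d∣p₁ * Y i

    d-divides : ∀ i → p i ≡ + d * cofactor i
    d-divides i = lem (p i) (p 0ℤ) (p 1ℤ) (X i) (Y i) (+ d) (+ ℕ.quotient d∣p₀) (+ ℕ.quotient d∣p₁)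
      (decompose p-solves i) (d-quotient (p-pos 0ℤ) d∣p₀) (d-quotient (p-pos 1ℤ) d∣p₁)
      where
      lem : ∀ a b c x y d u v → a ≡ b * x + c * y → b ≡ u * d → c ≡ v * d → a ≡ d * (u * x + v * y)
      lem a b c x y d u v e refl refl = ≡-by e (solve (a ∷ x ∷ y ∷ d ∷ u ∷ v ∷ []))

    d≤p : ∀ i → + d ≤ p i
    d≤p i = lem (+ d) (cofactor i) (p i) (d-divides i) d-pos (p-pos i)
      where
      dc-d : ∀ d c → 0ℤ < d → 0ℤ < c → d ≤ d * c
      dc-d d c q r = ≤-by (<⇒≤ q ⊗ gap< r) (solve (d ∷ c ∷ []))
      c≰0 : ∀ d c → 0ℤ < d → 0ℤ < d * c → ¬ c ≤ 0ℤ
      c≰0 d c q r s = ⊥-by (<⇒≤ q ⊗ gap s ⊕ gap< r) (solve (d ∷ c ∷ []))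
      lem : ∀ d c x → x ≡ d * c → 0ℤ < d → 0ℤ < x → d ≤ x
      lem d c .(d * c) refl q r = dc-d d c q (≰⇒> (c≰0 d c q r))

    p-ptolemy : ∀ i j k → D i k * p j ≡ D i j * p k + D j k * p i
    p-ptolemy = ptolemy-combination Yₙ (1ℤ - Xₙ)

    -- Ptolemy's relation becomes `p j = (D i j + D j k) * p i`, so `p i` divides `p 0` and `p 1`,
    -- hence `d`.
    p-coprime : ∀ {i k} → D i k ≡ 1ℤ → p i ≡ p k → p i ≡ + d
    p-coprime {i} {k} Dik eq = ≤-antisym (subst (_≤ + d) (sym (+abs (p-pos i)))
        (+≤+ (ℕ.∣⇒≤ {{ℕ.>-nonZero d>0}} (d-greatest (divides 0ℤ) (divides 1ℤ)))))
      (d≤p i)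
      where
      divides : ∀ j → ∣ p i ∣ ℕ.∣ ∣ p j ∣
      divides j = ℕ.divides ∣ D i j + D j k ∣
        (trans (cong ∣_∣ (lem (p i) (p j) (p k) (D i k) (D i j) (D j k) Dik eq (p-ptolemy i j k)))
               (abs-* (D i j + D j k) (p i)))
        where
        lem : ∀ x y z a b c → a ≡ 1ℤ → x ≡ z → a * y ≡ b * z + c * x → y ≡ (b + c) * x
        lem x y z .1ℤ b c refl refl e = ≡-by e (solve (x ∷ y ∷ b ∷ c ∷ []))

    polygon : Polygon n
    polygon = record
      { D = D ; p = p ; g = + d
      ; ptolemy = ptolemy ; ptolemyₚ = p-ptolemy ; D-diag = D-diag ; D-side = D-side ; D-pos = λ {i} {j} → D-pos {i} {j}
      ; p-pos = p-pos ; D-shift = D-shift ; p-shift = p-shift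
      ; g-pos = d-pos ; g≤p = d≤p ; coprime = λ {i} {k} → p-coprime {i} {k}
      }

    open ToTriangulation polygon using (triangulation; regions-sum)

    arises : ArisesFromPuncturedDisc F
    arises = n , n≢0 , triangulation , 0ℤ , λ k x → quiddity≡ (res-unique x k (lem (+ toℕ x) (k * + n)))
      where
      lem : ∀ x y → 0ℤ + x + y ≡ x + y
      lem = solve-∀
      quiddity≡ : ∀ {i x} → res i ≡ x → quiddity F i ≡ + regionsAt triangulation x
      -- Both numbers, multiplied by the positive `p i`, give `p (i - 1) + p (i + 1)`.
      quiddity≡ {i} refl = *-cancelʳ-≡ (quiddity F i) (+ regionsAt triangulation (res i)) (p i)
        {{>-nonZero (p-pos i)}} (trans (sym (p-solves i)) (regions-sum i))

corollary4p5 : (F : InfiniteFrieze) (n : ℕ) → IsMinimalPeriod F n →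
    ((∃[ k ] (k ℕ.> 0 × growth F n k > + 2)) ⇔ (∀ k → k ℕ.> 0 → growth F n k > + 2)) ×
    ((∀ k → k ℕ.> 0 → growth F n k > + 2) ⇔ (¬ ArisesFromPuncturedDisc F))
corollary4p5 F n (period , _) =
  -- A single coefficient above 2 excludes trace 2, where all of them equal 2; any other trace
  -- exceeds 2.
  mk⇔ (λ (k , _ , s>2) → unbounded λ trace≡2 → <⇒≢ s>2 (sym (bounded trace≡2 k)))
      (λ all → 1 , ℕ.≤-refl , all 1 ℕ.≤-refl) ,
  mk⇔ (λ all disc → let k , k>0 , s≡2 = arises⇒growth≡2 disc in <⇒≢ (all k k>0) (sym s≡2))
      (λ ¬disc → unbounded (¬disc ∘ Parabolic.arises))
  where
  open Disc F n period
  open FriezeVectors F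
  open WithPeriod n period
  bounded : trace ≡ + 2 → ∀ k → growth F n k ≡ + 2
  bounded trace≡2 k = trans (growth≡S n 1≤n k) (S≡2 trace≡2 k)
  unbounded : trace ≢ + 2 → ∀ k → k ℕ.> 0 → growth F n k > + 2
  unbounded trace≢2 (suc k) _ = subst (+ 2 <_) (sym (growth≡S n 1≤n (suc k)))
    (S>2 (≤∧≢⇒< 2≤trace (trace≢2 ∘ sym)) k)
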